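{- For all parallel arrows $\mathfrak s,\mathfrak t$ of $\mathcal T(\mathrm{Diag}_{PB})$ (probabilistic Boolean tapes): if $\langle\!\langle\mathfrak s\rangle\!\rangle=\langle\!\langle\mathfrak t\rangle\!\rangle$, then $\mathfrak s\mathrel{\dot\sim}\mathfrak t$.
   Context: **Circuits.** Composition is written in diagrammatic order with $;$. For a set $\Sigma$ of generators over a single sort $A$, each with an arity $A^n$ and a coarity $A^m$ ($A^0$ is the empty word, the monoidal unit, also written $1$), $\mathrm{Diag}_\Sigma$ is the strict symmetric monoidal category $(\otimes,A^0)$ freely generated by $\Sigma$; its objects are the words $A^n$, $n\in\mathbb N$. A monoidal theory $\mathbb T=(\Sigma,E)$ has a set $E$ of pairs of parallel arrows; $=_{\mathbb T}$ is the smallest congruence (for $;$ and $\otimes$) containing $E$. **Signatures.** $B$ has generators $\wedge\colon A^2\to A$, $\neg\colon A\to A$, $\mathsf{tt}\colon A^0\to A$, $\mathsf{copy}\colon A\to A^2$, $\mathsf{del}\colon A\to A^0$. $PB=B\cup\{\mathsf{cocopy}\colon A^2\to A\}$. Put $\mathsf{ff}:=\mathsf{tt};\neg$, $\vee:=(\neg\otimes\neg);\wedge;\neg$, $\mathsf{xnor}:=(\mathsf{copy}\otimes\mathsf{copy});(\mathrm{id}_A\otimes\sigma_{A,A}\otimes\mathrm{id}_A);(\wedge\otimes((\neg\otimes\neg);\wedge));\vee$, $\mathsf{test}_1:=(\mathsf{tt}\otimes\mathrm{id}_A);\mathsf{cocopy};\mathsf{del}$, $\mathsf{test}_0:=(\mathsf{ff}\otimes\mathrm{id}_A);\mathsf{cocopy};\mathsf{del}$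 (both $A\to A^0$), $\mathsf{fail}:=(\mathsf{tt}\otimes\mathsf{ff});\mathsf{cocopy}\colon A^0\to A$. **Theory $\mathbb{PB}$** (signature $PB$; $\mathrm{id}=\mathrm{id}_A$, $\sigma=\sigma_{A,A}$). Boolean axioms: $(\wedge\otimes\mathrm{id});\wedge=(\mathrm{id}\otimes\wedge);\wedge$; $(\mathsf{tt}\otimes\mathrm{id});\wedge=\mathrm{id}=(\mathrm{id}\otimes\mathsf{tt});\wedge$; $\sigma;\wedge=\wedge$; $(\mathrm{id}\otimes\vee);\wedge=(\mathsf{copy}\otimes\mathrm{id}\otimes\mathrm{id});(\mathrm{id}\otimes\sigma\otimes\mathrm{id});(\wedge\otimes\wedge);\vee$; $\mathsf{copy};\wedge=\mathrm{id}$; $\mathsf{copy};(\mathrm{id}\otimes\neg);\wedge=\mathsf{del};\mathsf{ff}$; $\neg;\neg=\mathrm{id}$; $(\mathsf{copy},\mathsf{del})$ is a commutative comonoid; $\wedge;\mathsf{copy}=(\mathsf{copy}\otimes\mathsf{copy});(\mathrm{id}\otimes\sigma\otimes\mathrm{id});(\wedge\otimes\wedge)$; $\neg;\mathsf{copy}=\mathsf{copy};(\neg\otimes\neg)$; $\mathsf{tt};\mathsf{copy}=\mathsf{tt}\otimes\mathsf{tt}$; $\wedge;\mathsf{del}=\mathsf{del}\otimes\mathsf{del}$; $\neg;\mathsf{del}=\mathsf{del}$; $\mathsf{tt};\mathsf{del}=\mathrm{id}_{A^0}$. Partiality axioms: $\mathsf{cocopy}$ is associative and commutative; $\mathsf{copy};\mathsf{cocopy}=\mathrm{id}$;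 $(\mathsf{copy}\otimes\mathrm{id});(\mathrm{id}\otimes\mathsf{cocopy})=\mathsf{cocopy};\mathsf{copy}=(\mathrm{id}\otimes\mathsf{copy});(\mathsf{cocopy}\otimes\mathrm{id})$; $(\mathsf{copy}\otimes\mathsf{copy});(\mathrm{id}\otimes\sigma\otimes\mathrm{id});((\mathsf{xnor};\mathsf{test}_1)\otimes\wedge)=\mathsf{cocopy}$; $\wedge;\mathsf{test}_1=\mathsf{test}_1\otimes\mathsf{test}_1$. **Tapes.** Let $\mathbf C$ be a strict symmetric monoidal category with objects the words $A^n$ (here $\mathbf C=\mathrm{Diag}_{PB}$); write $UV$ for $U\otimes V$. Objects of $\mathcal T(\mathbf C)$ are finite lists $P=U_1\oplus\dots\oplus U_k$ of objects of $\mathbf C$ ($0$ is the empty list, $\oplus$ concatenation). Terms are generated (with evident typing) by $\Delta^p_U\colon U\to U\oplus U$ ($p\in(0,1)$), $!_U\colon U\to 0$, $\nabla_U\colon U\oplus U\to U$, $\text{¡}_U\colon 0\to U$, $\underline c\colon U\to V$ for each arrow $c\colon U\to V$ of $\mathbf C$, $\mathrm{id}_U$, $\mathrm{id}_0$, $\sigma^\oplus_{U,V}\colon U\oplus V\to V\oplus U$, and closed under $;$ and $\oplus$. Identities and $\sigma^\oplus$ extend to lists as usual; $\Delta^p_0=\,!_0=\nabla_0=\text{¡}_0=\mathrm{id}_0$, $!_{U\oplus P}=\,!_U\oplus\,!_P$, $\text{¡}_{U\oplus P}=\text{¡}_U\oplus\text{¡}_P$, $\Delta^p_{U\oplus P}=(\Delta^p_U\oplus\Delta^p_P);(\mathrm{id}_U\oplus\sigma^\oplus_{U,P}\oplus\mathrm{id}_P)$,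 $\nabla_{U\oplus P}=(\mathrm{id}_U\oplus\sigma^\oplus_{P,U}\oplus\mathrm{id}_P);(\nabla_U\oplus\nabla_P)$. Arrows are terms modulo the congruence (for $;$, $\oplus$) generated by: strict symmetric monoidal category laws for $(\oplus,0)$; $\underline{\mathrm{id}_U}=\mathrm{id}_U$, $\underline{c;d}=\underline c;\underline d$; $(\nabla_P,\text{¡}_P)$ is a commutative monoid, natural ($\nabla_P;f=(f\oplus f);\nabla_Q$, $\text{¡}_P;f=\text{¡}_Q$ for all $f\colon P\to Q$); and, for $p,q\in(0,1)$, $\Delta^p_P;(\Delta^q_P\oplus\mathrm{id}_P)=\Delta^{\tilde p}_P;(\mathrm{id}_P\oplus\Delta^{\tilde q}_P)$ with $\tilde p=pq$, $\tilde q=\frac{p(1-q)}{1-pq}$, $\Delta^p_P;\sigma^\oplus_{P,P}=\Delta^{1-p}_P$, $\Delta^p_P;\nabla_P=\mathrm{id}_P$, $f;\Delta^p_Q=\Delta^p_P;(f\oplus f)$, $f;!_Q=\,!_P$ for all $f\colon P\to Q$. **Tensor of tapes.** For $P=\bigoplus_iU_i$, $Q=\bigoplus_jV_j$ put $P\otimes Q=\bigoplus_i\bigoplus_jU_iV_j$. Left distributors $\delta_{P,Q,R}\colon P\otimes(Q\oplus R)\to(P\otimes Q)\oplus(P\otimes R)$: $\delta_{0,Q,R}=\mathrm{id}_0$, $\delta_{U\oplus P',Q,R}=(\mathrm{id}_{U\otimes(Q\oplus R)}\oplus\delta_{P',Q,R});(\mathrm{id}_{U\otimes Q}\oplus\sigma^\oplus_{U\otimes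 R,P'\otimes Q}\oplus\mathrm{id}_{P'\otimes R})$. Whiskerings: $L_U$ preserves $;,\oplus,\mathrm{id}_0$, and $L_U(\underline c)=\underline{\mathrm{id}_U\otimes c}$, $L_U(\sigma^\oplus_{V,W})=\sigma^\oplus_{UV,UW}$, $L_U(\Delta^p_V)=\Delta^p_{UV}$ and likewise for $!,\nabla,\text{¡}$; $R_U$ is symmetric ($R_U(\underline c)=\underline{c\otimes\mathrm{id}_U}$, $R_U(\Delta^p_V)=\Delta^p_{VU}$, etc.). $L_0(\mathfrak t)=R_0(\mathfrak t)=\mathrm{id}_0$, $L_{W\oplus S}(\mathfrak t)=L_W(\mathfrak t)\oplus L_S(\mathfrak t)$, $R_{W\oplus S}(\mathfrak t)=\delta_{P,W,S};(R_W(\mathfrak t)\oplus R_S(\mathfrak t));\delta_{Q,W,S}^{ -1}$ for $\mathfrak t\colon P\to Q$. For $\mathfrak t_1\colon P\to Q$, $\mathfrak t_2\colon R\to S$: $\mathfrak t_1\otimes\mathfrak t_2:=L_P(\mathfrak t_2);R_S(\mathfrak t_1)$. **Convex structure.** For $f,g\colon P\to Q$, $p\in(0,1)$: $f+_pg:=\Delta^p_P;(f\oplus g);\nabla_Q$, $\star_{P,Q}:=\,!_P;\text{¡}_Q$, $p\cdot f:=f+_p\star_{P,Q}$. **Congruence $\dot\sim$** on $\mathcal T(\mathrm{Diag}_{PB})$: the smallest equivalence relation on parallel arrows, closed under $;$, $\oplus$ and $\otimes$, such that: $\underline c\mathrel{\dot\sim}\underline d$ whenever $c=_{\mathbb{PB}}d$;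 (T1) $\underline{\mathsf{fail}}\mathrel{\dot\sim}\star_{A^0,A}$; (T2) $\tfrac12\cdot\mathrm{id}_A\mathrel{\dot\sim}(\underline{\mathsf{test}_1};\underline{\mathsf{tt}})+_{1/2}(\underline{\mathsf{test}_0};\underline{\mathsf{ff}})$; (T3) if $p\cdot\mathfrak t\mathrel{\dot\sim}p\cdot\mathfrak s$ for some $p\in(0,1)$ then $\mathfrak t\mathrel{\dot\sim}\mathfrak s$. **Semantics.** Let $2=\{0,1\}$, $2^0=\{\bullet\}$. $\mathbf{Par}$ is the category of sets and partial functions, with $\otimes$ the cartesian product ($f_1\otimes f_2$ is defined where both components are). $[\![-]\!]_{PB}\colon\mathrm{Diag}_{PB}\to\mathbf{Par}$ is the symmetric monoidal functor with $A^n\mapsto2^n$, interpreting $\wedge,\neg,\mathsf{tt}$ as conjunction, negation, constant $1$, $\mathsf{copy}$ as $x\mapsto(x,x)$, $\mathsf{del}$ as $x\mapsto\bullet$, $\mathsf{cocopy}$ as $(x,y)\mapsto x$ if $x=y$, undefined otherwise. $\mathcal D_{\le}(X)$ is the set of finitely supported $d\colon X\to[0,1]$ with $\sum_xd(x)\le1$; $\mathbf{Kl}(\mathcal D_\le)$ is the Kleisli category: arrows $X\to Y$ are functions $f\colon X\to\mathcal D_\le(Y)$, $f(y\mid x):=f(x)(y)$, $(f;g)(z\mid x)=\sum_yf(y\mid x)g(z\mid y)$, identities $x\mapsto\delta_x$; $\oplus$ is disjoint union (coproduct). $J\colon\mathbf{Par}\to\mathbf{Kl}(\mathcal D_\le)$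 is the identity on objects, $J(f)(x)=\delta_{f(x)}$ if $f(x)$ is defined and the zero subdistribution otherwise. $\langle\!\langle-\rangle\!\rangle\colon\mathcal T(\mathrm{Diag}_{PB})\to\mathbf{Kl}(\mathcal D_\le)$ maps $\bigoplus_iA^{n_i}$ to $\bigoplus_i2^{n_i}$ (disjoint union), preserves $;$, $\oplus$, identities and $\sigma^\oplus$, sends $\underline c$ to $J([\![c]\!]_{PB})$, $\Delta^p_{A^n}$ to $x\mapsto p\,\delta_{\iota_1(x)}+(1-p)\,\delta_{\iota_2(x)}$, $!_{A^n}$ to the unique arrow $2^n\to\emptyset$, $\text{¡}_{A^n}$ to the unique arrow $\emptyset\to2^n$, and $\nabla_{A^n}$ to $\iota_i(x)\mapsto\delta_x$. -}

module Defs where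

open import Level using (_⊔_) renaming (suc to lsuc)
open import Algebra.Apartness.Bundles using (HeytingField; HeytingCommutativeRing)
open import Algebra.Bundles using (CommutativeRing)
import Algebra.Apartness.Properties.HeytingCommutativeRing as HCRProperties
import Algebra.Properties.Monoid.Mult as Mult
import Algebra.Properties.Ring as RingProperties
import Algebra.Properties.CommutativeSemigroup as CommutativeSemigroupProperties
open import Data.Bool using (Bool; true; false; not; _∧_; if_then_else_)
import Data.Bool.Properties as Bool
open import Data.Empty using (⊥; ⊥-elim)
open import Data.List using (List; []; _∷_; _++_; map; foldr)
open import Data.List.Membership.Propositional using (_∈_)
open import Data.List.Membership.Propositional.Properties
  using (∈-++⁺ˡ; ∈-++⁺ʳ; ∈-map⁺; ∈-map⁻)
open import Data.List.Properties using (++-assoc; ++-identityʳ; map-++; map-∘)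
open import Data.List.Relation.Unary.All using (All; []; _∷_)
open import Data.List.Relation.Unary.AllPairs using ([]; _∷_)
open import Data.List.Relation.Unary.Any using (here; there)
open import Data.List.Relation.Unary.Unique.Propositional using (Unique)
import Data.List.Relation.Unary.Unique.Propositional.Properties as Unique
open import Data.Maybe using (Maybe; just; nothing; maybe′; zipWith; _>>=_)
open import Data.Nat using (ℕ; zero; suc) renaming (_+_ to _+ℕ_; _≤_ to _≤ℕ_)
open import Data.Nat.Properties using (+-assoc; +-identityʳ)
open import Data.Product using (_×_; _,_; proj₁; proj₂; ∃-syntax)
open import Data.Sum using (_⊎_; inj₁; inj₂; [_,_]′)
import Data.Sum as Sum
open import Data.Sum.Properties using (inj₁-injective; inj₂-injective) renaming (≡-dec to ⊎-≡-dec)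
open import Data.Vec using (Vec; []; _∷_) renaming (_++_ to _++ᵛ_; take to takeᵛ; drop to dropᵛ)
open import Data.Vec.Properties using (∷-injectiveʳ) renaming (≡-dec to Vec-≡-dec)
open import Function using (_∘_; id)
open import Relation.Binary.Core using (Rel)
open import Relation.Binary.Definitions using (DecidableEquality)
open import Relation.Binary.PropositionalEquality as ≡ using (_≡_; _≢_; cong; cong₂)
import Relation.Binary.Reasoning.Setoid as SetoidReasoning
open import Relation.Binary.Structures using (IsStrictPartialOrder)
open import Relation.Nullary using (¬_; does; yes; no)

-- The real numbers, axiomatically: an Archimedean, Cauchy-complete ordered
-- field. Classically these axioms determine ℝ up to isomorphism. They are
-- phrased so that constructive reals (e.g. Bishop's) satisfy them as well: no
-- decidability of _≈_ or _<_ is required.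

record Reals c ℓ₁ ℓ₂ : Set (lsuc (c ⊔ ℓ₁ ⊔ ℓ₂)) where
  field
    heytingField : HeytingField c ℓ₁ ℓ₂

  open HeytingField heytingField public

  commutativeRing : CommutativeRing c ℓ₁
  commutativeRing = HeytingCommutativeRing.commutativeRing heytingCommutativeRing

  open Mult (CommutativeRing.+-monoid commutativeRing) using () renaming (_×_ to _×ℕ_)

  infix 4 _<_ _≤_

  field
    _<_                  : Rel Carrier ℓ₂
    isStrictPartialOrder : IsStrictPartialOrder _≈_ _<_
    #⇒≶                  : ∀ {x y} → x # y → x < y ⊎ y < x
    <⇒#                  : ∀ {x y} → x < y → x # y
    +-monoˡ-<            : ∀ z {x y} → x < y → x + z < y + z
    *-pos                : ∀ {x y} → 0# < x → 0# < y → 0# < x * y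
    archimedean          : ∀ x → ∃[ n ] x < n ×ℕ 1#

  _≤_ : Rel Carrier ℓ₂
  x ≤ y = ¬ (y < x)

  ∣_-_∣<_ : Carrier → Carrier → Carrier → Set ℓ₂
  ∣ x - y ∣< ε = x - y < ε × y - x < ε

  IsCauchy : (ℕ → Carrier) → Set (c ⊔ ℓ₂)
  IsCauchy u = ∀ ε → 0# < ε → ∃[ N ] (∀ m n → N ≤ℕ m → N ≤ℕ n → ∣ u m - u n ∣< ε)

  _ConvergesTo_ : (ℕ → Carrier) → Carrier → Set (c ⊔ ℓ₂)
  u ConvergesTo l = ∀ ε → 0# < ε → ∃[ N ] (∀ n → N ≤ℕ n → ∣ u n - l ∣< ε)

  field
    complete : ∀ u → IsCauchy u → ∃[ l ] u ConvergesTo l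

module RealProperties {c ℓ₁ ℓ₂} (R : Reals c ℓ₁ ℓ₂) where
  open Reals R
  open CommutativeRing commutativeRing using (ring)
  open RingProperties ring
  open HCRProperties heytingCommutativeRing using (1#0; x-0≈x; invertibleˡ⇒#)
  open IsStrictPartialOrder isStrictPartialOrder public
    using (<-resp-≈) renaming (irrefl to <-irrefl; trans to <-trans)
  open SetoidReasoning setoid

  <-respˡ : ∀ {x y z} → x ≈ y → x < z → y < z
  <-respˡ = proj₂ <-resp-≈

  <-respʳ : ∀ {x y z} → x ≈ y → z < x → z < y
  <-respʳ = proj₁ <-resp-≈

  <-asym : ∀ {x y} → x < y → ¬ (y < x)
  <-asym p q = <-irrefl refl (<-trans p q)

  <-cotrans : ∀ {x y} → x < y → ∀ z → x < z ⊎ z < y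
  <-cotrans x<y z with #-cotrans (<⇒# x<y) z
  ... | inj₁ x#z = Sum.map id (λ z<x → <-trans z<x x<y) (#⇒≶ x#z)
  ... | inj₂ z#y = Sum.swap (Sum.map id (<-trans x<y) (#⇒≶ z#y))

  +-monoʳ-< : ∀ z {x y} → x < y → z + x < z + y
  +-monoʳ-< z p = <-respˡ (+-comm _ z) (<-respʳ (+-comm _ z) (+-monoˡ-< z p))

  x+z-z≈x : ∀ x z → (x + z) - z ≈ x
  x+z-z≈x x z = trans (Reals.+-assoc R x z (- z)) (trans (+-congˡ (-‿inverseʳ z)) (Reals.+-identityʳ R x))

  x-z+z≈x : ∀ x z → (x - z) + z ≈ x
  x-z+z≈x x z = trans (Reals.+-assoc R x (- z) z) (trans (+-congˡ (-‿inverseˡ z)) (Reals.+-identityʳ R x))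

  +-cancelʳ-< : ∀ z {x y} → x + z < y + z → x < y
  +-cancelʳ-< z p = <-respˡ (x+z-z≈x _ z) (<-respʳ (x+z-z≈x _ z) (+-monoˡ-< (- z) p))

  +-cancelˡ-< : ∀ z {x y} → z + x < z + y → x < y
  +-cancelˡ-< z p = +-cancelʳ-< z (<-respˡ (+-comm z _) (<-respʳ (+-comm z _) p))

  x<y⇒0<y-x : ∀ {x y} → x < y → 0# < y - x
  x<y⇒0<y-x {x} p = <-respˡ (-‿inverseʳ x) (+-monoˡ-< (- x) p)

  y-x<0⇒y<x : ∀ {x y} → y - x < 0# → y < x
  y-x<0⇒y<x {x} p = <-respˡ (x-z+z≈x _ x) (<-respʳ (+-identityˡ x) (+-monoˡ-< x p))

  x<0⇒0<-x : ∀ {x} → x < 0# → 0# < - x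
  x<0⇒0<-x p = <-respʳ (+-identityˡ _) (x<y⇒0<y-x p)

  0<1 : 0# < 1#
  0<1 with #⇒≶ 1#0
  ... | inj₂ p = p
  ... | inj₁ p = <-respʳ -1*-1≈1 (*-pos (x<0⇒0<-x p) (x<0⇒0<-x p))
    where
    -1*-1≈1 : - 1# * - 1# ≈ 1#
    -1*-1≈1 = trans (-1*x≈-x (- 1#)) (-‿involutive 1#)

  *-monoˡ-< : ∀ {x y z} → 0# < z → x < y → z * x < z * y
  *-monoˡ-< {x} {y} {z} 0<z x<y =
    <-respˡ (+-identityˡ _) (<-respʳ e (+-monoˡ-< (z * x) (*-pos 0<z (x<y⇒0<y-x x<y))))
    where
    e : z * (y - x) + z * x ≈ z * y
    e = trans (sym (distribˡ z (y - x) x)) (*-congˡ (x-z+z≈x y x))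

  reciprocal : ∀ x → 0# < x → ∃[ y ] x * y ≈ 1#
  reciprocal x 0<x with #⇒invertible (#-sym (<⇒# 0<x))
  ... | y , _ , e = y , trans (*-congʳ (sym (x-0≈x x))) e

  infix 8 1/_

  1/_ : ∀ {x} → 0# < x → Carrier
  1/_ 0<x = proj₁ (reciprocal _ 0<x)

  1/-inverseʳ : ∀ {x} (0<x : 0# < x) → x * 1/ 0<x ≈ 1#
  1/-inverseʳ 0<x = proj₂ (reciprocal _ 0<x)

  1/-pos : ∀ {x} (0<x : 0# < x) → 0# < 1/ 0<x
  1/-pos {x} 0<x with #⇒≶ {1/ 0<x} {0#}
    (invertibleˡ⇒# (x , trans (*-congˡ (x-0≈x _)) (1/-inverseʳ 0<x)))
  ... | inj₂ p = p
  ... | inj₁ p = ⊥-elim (<-asym 0<1 (<-respˡ (1/-inverseʳ 0<x)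
                   (<-respʳ (zeroʳ x) (*-monoˡ-< 0<x p))))

  ≤-refl : ∀ {x} → x ≤ x
  ≤-refl = <-irrefl refl

  ≤-trans : ∀ {x y z} → x ≤ y → y ≤ z → x ≤ z
  ≤-trans {y = y} p q z<x = [ q , p ]′ (<-cotrans z<x y)

  ≤-respˡ : ∀ {x y z} → x ≈ y → x ≤ z → y ≤ z
  ≤-respˡ e p q = p (<-respʳ (sym e) q)

  ≤-respʳ : ∀ {x y z} → x ≈ y → z ≤ x → z ≤ y
  ≤-respʳ e p q = p (<-respˡ (sym e) q)

  +-mono-≤ : ∀ {x y u v} → x ≤ y → u ≤ v → x + u ≤ y + v
  +-mono-≤ {x} {y} {u} {v} p q r =
    [ (λ s → p (+-cancelʳ-< v s)) , (λ s → q (+-cancelˡ-< x s)) ]′ (<-cotrans r (x + v))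

  +-nonneg : ∀ {x y} → 0# ≤ x → 0# ≤ y → 0# ≤ x + y
  +-nonneg p q = ≤-respˡ (+-identityˡ 0#) (+-mono-≤ p q)

  *-nonneg : ∀ {x y} → 0# ≤ x → 0# ≤ y → 0# ≤ x * y
  *-nonneg {x} {y} 0≤x 0≤y xy<0 with #⇒invertible (<⇒# xy<0)
  ... | w , e , _ = <-asym xy<0 (*-pos (positive 0≤x x#0) (positive 0≤y y#0))
    where
    positive : ∀ {z} → 0# ≤ z → z # 0# → 0# < z
    positive 0≤z z#0 = [ (λ z<0 → ⊥-elim (0≤z z<0)) , id ]′ (#⇒≶ z#0)
    e′ : w * (x * y) ≈ 1#
    e′ = trans (*-congˡ (sym (x-0≈x _))) e
    y#0 : y # 0#
    y#0 = invertibleˡ⇒# (w * x , trans (*-congˡ (x-0≈x y)) (trans (*-assoc w x y) e′))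
    x#0 : x # 0#
    x#0 = invertibleˡ⇒# (w * y , (begin
      w * y * (x - 0#) ≈⟨ *-congˡ (x-0≈x x) ⟩
      w * y * x        ≈⟨ *-assoc w y x ⟩
      w * (y * x)      ≈⟨ *-congˡ (*-comm y x) ⟩
      w * (x * y)      ≈⟨ e′ ⟩
      1#               ∎))

  *-≤-factor : ∀ {x y} → 0# ≤ x → y ≤ 1# → x * y ≤ x
  *-≤-factor {x} {y} 0≤x y≤1 x<xy = *-nonneg 0≤x (λ p → y≤1 (y-x<0⇒y<x p)) (<-respˡ e lt)
    where
    lt : x - x * y < 0#
    lt = <-respʳ (-‿inverseʳ (x * y)) (+-monoˡ-< (- (x * y)) x<xy)
    e : x - x * y ≈ x * (1# - y)
    e = begin
      x - x * y          ≈⟨ +-cong (*-identityʳ x) (sym (-‿distribʳ-* x y)) ⟨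
      x * 1# + x * (- y) ≈⟨ distribˡ x 1# (- y) ⟨
      x * (1# - y)       ∎

  <⇒≤ : ∀ {x y} → x < y → x ≤ y
  <⇒≤ = <-asym

module OpenUnitInterval {c ℓ₁ ℓ₂} (R : Reals c ℓ₁ ℓ₂) where
  open Reals R
  open RealProperties R
  open RingProperties (CommutativeRing.ring commutativeRing)

  record Prob : Set (c ⊔ ℓ₂) where
    field
      value   : Carrier
      value>0 : 0# < value
      value<1 : value < 1#

  open Prob public

  1-_ : Prob → Prob
  1- p = record
    { value   = 1# - value p
    ; value>0 = x<y⇒0<y-x (value<1 p)
    ; value<1 = <-respʳ (x-z+z≈x 1# (value p))
                  (<-respˡ (Reals.+-identityʳ R _) (+-monoʳ-< (1# - value p) (value>0 p)))
    }

  infixl 7 _*ᵖ_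

  _*ᵖ_ : Prob → Prob → Prob
  p *ᵖ q = record
    { value   = value p * value q
    ; value>0 = *-pos (value>0 p) (value>0 q)
    ; value<1 = <-trans (<-respʳ (*-identityʳ _) (*-monoˡ-< (value>0 p) (value<1 q))) (value<1 p)
    }

  -- p(1-q) / (1-pq), the parameter q̃ of Δ-assoc.
  reassoc : Prob → Prob → Prob
  reassoc p q = record
    { value   = num * inv
    ; value>0 = *-pos num>0 inv>0
    ; value<1 = <-respˡ (*-comm inv num)
                  (<-respʳ (trans (*-comm inv _) (1/-inverseʳ den>0)) (*-monoˡ-< inv>0 num<den))
    }
    where
    num = value p * (1# - value q)
    num>0 : 0# < num
    num>0 = *-pos (value>0 p) (value>0 (1- q))
    den>0 : 0# < 1# - value p * value q
    den>0 = value>0 (1- (p *ᵖ q))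
    inv = 1/ den>0
    inv>0 : 0# < inv
    inv>0 = 1/-pos den>0
    num<den : num < 1# - value p * value q
    num<den = <-respˡ
      (sym (trans (distribˡ _ 1# _) (+-cong (*-identityʳ _) (sym (-‿distribʳ-* _ _)))))
      (+-monoˡ-< _ (value<1 p))

  ½ : Prob
  ½ = record
    { value   = h
    ; value>0 = h>0
    ; value<1 = <-respˡ (+-identityˡ h) (<-respʳ h+h≈1 (+-monoˡ-< h h>0))
    }
    where
    2>0 : 0# < 1# + 1#
    2>0 = <-trans 0<1 (<-respˡ (+-identityˡ 1#) (+-monoˡ-< 1# 0<1))
    h = 1/ 2>0
    h>0 : 0# < h
    h>0 = 1/-pos 2>0
    h+h≈1 : h + h ≈ 1#
    h+h≈1 = trans (sym (trans (distribʳ h 1# 1#) (+-cong (*-identityˡ h) (*-identityˡ h))))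
              (1/-inverseʳ 2>0)

module Circuits (Gen : ℕ → ℕ → Set) where

  infixr 5 _⨟_
  infixr 7 _⊗_

  -- The object Aⁿ is represented by n. Arrows of Diag are these terms up to
  -- `[ NoAxioms ]_≈_` below.
  data Diag : ℕ → ℕ → Set where
    gen : ∀ {n m} → Gen n m → Diag n m
    idᶜ : ∀ n → Diag n n
    σ   : ∀ n m → Diag (n +ℕ m) (m +ℕ n)
    _⨟_ : ∀ {n m k} → Diag n m → Diag m k → Diag n k
    _⊗_ : ∀ {n m n′ m′} → Diag n m → Diag n′ m′ → Diag (n +ℕ n′) (m +ℕ m′)

  castᶜ : ∀ {n n′ m m′} → n ≡ n′ → m ≡ m′ → Diag n m → Diag n′ m′
  castᶜ ≡.refl ≡.refl c = c

  Axioms : Set₁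
  Axioms = ∀ {n m} → Diag n m → Diag n m → Set

  NoAxioms : Axioms
  NoAxioms _ _ = ⊥

  -- The smallest congruence containing E and the laws of strict symmetric
  -- monoidal categories.
  infix 4 [_]_≈_

  data [_]_≈_ (E : Axioms) : ∀ {n m} → Diag n m → Diag n m → Set where
    axiom   : ∀ {n m} {c d : Diag n m} → E c d → [ E ] c ≈ d
    ≈-refl  : ∀ {n m} {c : Diag n m} → [ E ] c ≈ c
    ≈-sym   : ∀ {n m} {c d : Diag n m} → [ E ] c ≈ d → [ E ] d ≈ c
    ≈-trans : ∀ {n m} {c d e : Diag n m} → [ E ] c ≈ d → [ E ] d ≈ e → [ E ] c ≈ e
    ⨟-cong  : ∀ {n m k} {c c′ : Diag n m} {d d′ : Diag m k} →
              [ E ] c ≈ c′ → [ E ] d ≈ d′ → [ E ] (c ⨟ d) ≈ (c′ ⨟ d′)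
    ⊗-cong  : ∀ {n m n′ m′} {c c′ : Diag n m} {d d′ : Diag n′ m′} →
              [ E ] c ≈ c′ → [ E ] d ≈ d′ → [ E ] (c ⊗ d) ≈ (c′ ⊗ d′)

    ⨟-assoc : ∀ {n m k l} {c : Diag n m} {d : Diag m k} {e : Diag k l} →
              [ E ] ((c ⨟ d) ⨟ e) ≈ (c ⨟ (d ⨟ e))
    ⨟-idˡ   : ∀ {n m} {c : Diag n m} → [ E ] (idᶜ n ⨟ c) ≈ c
    ⨟-idʳ   : ∀ {n m} {c : Diag n m} → [ E ] (c ⨟ idᶜ m) ≈ c

    ⊗-id     : ∀ n m → [ E ] (idᶜ n ⊗ idᶜ m) ≈ idᶜ (n +ℕ m)
    ⊗-⨟      : ∀ {n m k n′ m′ k′} {c : Diag n m} {d : Diag m k} {c′ : Diag n′ m′} {d′ : Diag m′ k′} →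
               [ E ] ((c ⨟ d) ⊗ (c′ ⨟ d′)) ≈ ((c ⊗ c′) ⨟ (d ⊗ d′))
    ⊗-assoc  : ∀ {n m n′ m′ n″ m″} {c : Diag n m} {d : Diag n′ m′} {e : Diag n″ m″} →
               [ E ] castᶜ (+-assoc n n′ n″) (+-assoc m m′ m″) ((c ⊗ d) ⊗ e) ≈ (c ⊗ (d ⊗ e))
    ⊗-unitˡ  : ∀ {n m} {c : Diag n m} → [ E ] (idᶜ 0 ⊗ c) ≈ c
    ⊗-unitʳ  : ∀ {n m} {c : Diag n m} →
               [ E ] castᶜ (+-identityʳ n) (+-identityʳ m) (c ⊗ idᶜ 0) ≈ c

    σ-natural : ∀ {n m n′ m′} {c : Diag n m} {d : Diag n′ m′} →
                [ E ] ((c ⊗ d) ⨟ σ m m′) ≈ (σ n n′ ⨟ (d ⊗ c))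
    σ-inverse : ∀ n m → [ E ] (σ n m ⨟ σ m n) ≈ idᶜ (n +ℕ m)
    σ-hexagon : ∀ n m k →
                [ E ] castᶜ (≡.sym (+-assoc n m k)) (+-assoc m k n) (σ n (m +ℕ k)) ≈
                      ((σ n m ⊗ idᶜ k) ⨟ castᶜ (≡.sym (+-assoc m n k)) ≡.refl (idᶜ m ⊗ σ n k))

data PB : ℕ → ℕ → Set where
  and    : PB 2 1
  neg    : PB 1 1
  tt     : PB 0 1
  copy   : PB 1 2
  del    : PB 1 0
  cocopy : PB 2 1

open Circuits PB public

pattern ∧ᶜ      = gen and
pattern ¬ᶜ      = gen neg
pattern ttᶜ     = gen tt
pattern copyᶜ   = gen copy
pattern delᶜ    = gen del
pattern cocopyᶜ = gen cocopy

idA : Diag 1 1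
idA = idᶜ 1

σA : Diag 2 2
σA = σ 1 1

ffᶜ : Diag 0 1
ffᶜ = ttᶜ ⨟ ¬ᶜ

∨ᶜ : Diag 2 1
∨ᶜ = (¬ᶜ ⊗ ¬ᶜ) ⨟ ∧ᶜ ⨟ ¬ᶜ

xnor : Diag 2 1
xnor = (copyᶜ ⊗ copyᶜ) ⨟ (idA ⊗ σA ⊗ idA) ⨟ (∧ᶜ ⊗ ((¬ᶜ ⊗ ¬ᶜ) ⨟ ∧ᶜ)) ⨟ ∨ᶜ

test₁ : Diag 1 0
test₁ = (ttᶜ ⊗ idA) ⨟ cocopyᶜ ⨟ delᶜ

test₀ : Diag 1 0
test₀ = (ffᶜ ⊗ idA) ⨟ cocopyᶜ ⨟ delᶜ

fail : Diag 0 1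
fail = (ttᶜ ⊗ ffᶜ) ⨟ cocopyᶜ

data PBAxioms : Axioms where
  ∧-assoc     : PBAxioms ((∧ᶜ ⊗ idA) ⨟ ∧ᶜ) ((idA ⊗ ∧ᶜ) ⨟ ∧ᶜ)
  ∧-unitˡ     : PBAxioms ((ttᶜ ⊗ idA) ⨟ ∧ᶜ) idA
  ∧-unitʳ     : PBAxioms ((idA ⊗ ttᶜ) ⨟ ∧ᶜ) idA
  ∧-comm      : PBAxioms (σA ⨟ ∧ᶜ) ∧ᶜ
  ∧-distrib-∨ : PBAxioms ((idA ⊗ ∨ᶜ) ⨟ ∧ᶜ)
                         ((copyᶜ ⊗ idA ⊗ idA) ⨟ (idA ⊗ σA ⊗ idA) ⨟ (∧ᶜ ⊗ ∧ᶜ) ⨟ ∨ᶜ)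
  ∧-idem      : PBAxioms (copyᶜ ⨟ ∧ᶜ) idA
  ∧-compl     : PBAxioms (copyᶜ ⨟ (idA ⊗ ¬ᶜ) ⨟ ∧ᶜ) (delᶜ ⨟ ffᶜ)
  ¬-invol     : PBAxioms (¬ᶜ ⨟ ¬ᶜ) idA
  copy-assoc  : PBAxioms (copyᶜ ⨟ (copyᶜ ⊗ idA)) (copyᶜ ⨟ (idA ⊗ copyᶜ))
  copy-unitˡ  : PBAxioms (copyᶜ ⨟ (delᶜ ⊗ idA)) idA
  copy-unitʳ  : PBAxioms (copyᶜ ⨟ (idA ⊗ delᶜ)) idA
  copy-comm   : PBAxioms (copyᶜ ⨟ σA) copyᶜ
  ∧-copy      : PBAxioms (∧ᶜ ⨟ copyᶜ) ((copyᶜ ⊗ copyᶜ) ⨟ (idA ⊗ σA ⊗ idA) ⨟ (∧ᶜ ⊗ ∧ᶜ))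
  ¬-copy      : PBAxioms (¬ᶜ ⨟ copyᶜ) (copyᶜ ⨟ (¬ᶜ ⊗ ¬ᶜ))
  tt-copy     : PBAxioms (ttᶜ ⨟ copyᶜ) (ttᶜ ⊗ ttᶜ)
  ∧-del       : PBAxioms (∧ᶜ ⨟ delᶜ) (delᶜ ⊗ delᶜ)
  ¬-del       : PBAxioms (¬ᶜ ⨟ delᶜ) delᶜ
  tt-del      : PBAxioms (ttᶜ ⨟ delᶜ) (idᶜ 0)

  cocopy-assoc  : PBAxioms ((cocopyᶜ ⊗ idA) ⨟ cocopyᶜ) ((idA ⊗ cocopyᶜ) ⨟ cocopyᶜ)
  cocopy-comm   : PBAxioms (σA ⨟ cocopyᶜ) cocopyᶜ
  special       : PBAxioms (copyᶜ ⨟ cocopyᶜ) idA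
  frobeniusˡ    : PBAxioms ((copyᶜ ⊗ idA) ⨟ (idA ⊗ cocopyᶜ)) (cocopyᶜ ⨟ copyᶜ)
  frobeniusʳ    : PBAxioms (cocopyᶜ ⨟ copyᶜ) ((idA ⊗ copyᶜ) ⨟ (cocopyᶜ ⊗ idA))
  cocopy-xnor   : PBAxioms ((copyᶜ ⊗ copyᶜ) ⨟ (idA ⊗ σA ⊗ idA) ⨟ ((xnor ⨟ test₁) ⊗ ∧ᶜ)) cocopyᶜ
  ∧-test₁       : PBAxioms (∧ᶜ ⨟ test₁) (test₁ ⊗ test₁)

-- Par restricted to finite sets: partial functions X ⇀ Y are X → Maybe Y.

⟦_⟧ᵍ : ∀ {n m} → PB n m → Vec Bool n → Maybe (Vec Bool m)
⟦ and ⟧ᵍ    (x ∷ y ∷ []) = just ((x ∧ y) ∷ [])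
⟦ neg ⟧ᵍ    (x ∷ [])     = just (not x ∷ [])
⟦ tt ⟧ᵍ     []           = just (true ∷ [])
⟦ copy ⟧ᵍ   (x ∷ [])     = just (x ∷ x ∷ [])
⟦ del ⟧ᵍ    (x ∷ [])     = just []
⟦ cocopy ⟧ᵍ (x ∷ y ∷ []) = if does (x Bool.≟ y) then just (x ∷ []) else nothing

⟦_⟧ : ∀ {n m} → Diag n m → Vec Bool n → Maybe (Vec Bool m)
⟦ gen g ⟧              xs = ⟦ g ⟧ᵍ xs
⟦ idᶜ n ⟧              xs = just xs
⟦ σ n m ⟧              xs = just (dropᵛ n xs ++ᵛ takeᵛ n xs)
⟦ c ⨟ d ⟧              xs = ⟦ c ⟧ xs >>= ⟦ d ⟧
⟦ _⊗_ {n = n} c d ⟧    xs = zipWith _++ᵛ_ (⟦ c ⟧ (takeᵛ n xs)) (⟦ d ⟧ (dropᵛ n xs))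

Objects : Set
Objects = List ℕ

infixr 6 _⊗ᵒ_

_⊗ᵒ_ : Objects → Objects → Objects
[]      ⊗ᵒ Q = []
(U ∷ P) ⊗ᵒ Q = map (U +ℕ_) Q ++ P ⊗ᵒ Q

⊗ᵒ-zeroʳ : ∀ P → P ⊗ᵒ [] ≡ []
⊗ᵒ-zeroʳ []      = ≡.refl
⊗ᵒ-zeroʳ (U ∷ P) = ⊗ᵒ-zeroʳ P

⊗ᵒ-distribʳ : ∀ P Q R → (P ++ Q) ⊗ᵒ R ≡ P ⊗ᵒ R ++ Q ⊗ᵒ R
⊗ᵒ-distribʳ []      Q R = ≡.refl
⊗ᵒ-distribʳ (U ∷ P) Q R =
  ≡.trans (cong (map (U +ℕ_) R ++_) (⊗ᵒ-distribʳ P Q R)) (≡.sym (++-assoc (map (U +ℕ_) R) _ _))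

middle-assoc : ∀ {a} {X : Set a} (A B C D : List X) → (A ++ B) ++ (C ++ D) ≡ A ++ (B ++ C) ++ D
middle-assoc A B C D =
  ≡.trans (++-assoc A B (C ++ D)) (cong (A ++_) (≡.sym (++-assoc B C D)))

module Tapes {c ℓ₁ ℓ₂} (R : Reals c ℓ₁ ℓ₂) where
  open Reals R using () renaming (_≈_ to _≈ℝ_)
  open OpenUnitInterval R

  infixr 5 _⨾_
  infixr 6 _⊕_

  -- Generators carry the subscript ₁; their extensions to lists are below.
  data Tape : Objects → Objects → Set (c ⊔ ℓ₂) where
    Δ₁   : Prob → ∀ U → Tape (U ∷ []) (U ∷ U ∷ [])
    !₁   : ∀ U → Tape (U ∷ []) []
    ∇₁   : ∀ U → Tape (U ∷ U ∷ []) (U ∷ [])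
    ¡₁   : ∀ U → Tape [] (U ∷ [])
    ⌜_⌝  : ∀ {U V} → Diag U V → Tape (U ∷ []) (V ∷ [])
    id₁  : ∀ U → Tape (U ∷ []) (U ∷ [])
    id₀  : Tape [] []
    σ₁   : ∀ U V → Tape (U ∷ V ∷ []) (V ∷ U ∷ [])
    _⨾_  : ∀ {P Q R} → Tape P Q → Tape Q R → Tape P R
    _⊕_  : ∀ {P Q P′ Q′} → Tape P Q → Tape P′ Q′ → Tape (P ++ P′) (Q ++ Q′)

  cast : ∀ {P P′ Q Q′} → P ≡ P′ → Q ≡ Q′ → Tape P Q → Tape P′ Q′
  cast ≡.refl ≡.refl t = t

  idᵗ : ∀ P → Tape P P
  idᵗ []      = id₀
  idᵗ (U ∷ P) = id₁ U ⊕ idᵗ P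

  σ₁⊕ : ∀ U Q → Tape (U ∷ Q) (Q ++ U ∷ [])
  σ₁⊕ U []      = id₁ U
  σ₁⊕ U (V ∷ Q) = (σ₁ U V ⊕ idᵗ Q) ⨾ (id₁ V ⊕ σ₁⊕ U Q)

  σ⊕ : ∀ P Q → Tape (P ++ Q) (Q ++ P)
  σ⊕ []      Q = cast ≡.refl (≡.sym (++-identityʳ Q)) (idᵗ Q)
  σ⊕ (U ∷ P) Q = (id₁ U ⊕ σ⊕ P Q) ⨾ cast ≡.refl (++-assoc Q (U ∷ []) P) (σ₁⊕ U Q ⊕ idᵗ P)

  Δ : Prob → ∀ P → Tape P (P ++ P)
  Δ p []      = id₀
  Δ p (U ∷ P) =
    (Δ₁ p U ⊕ Δ p P) ⨾
    cast ≡.refl (cong (U ∷_) (++-assoc P (U ∷ []) P)) (id₁ U ⊕ σ⊕ (U ∷ []) P ⊕ idᵗ P)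

  ! : ∀ P → Tape P []
  ! []      = id₀
  ! (U ∷ P) = !₁ U ⊕ ! P

  ∇ : ∀ P → Tape (P ++ P) P
  ∇ []      = id₀
  ∇ (U ∷ P) =
    cast (cong (U ∷_) (++-assoc P (U ∷ []) P)) ≡.refl (id₁ U ⊕ σ⊕ P (U ∷ []) ⊕ idᵗ P) ⨾
    (∇₁ U ⊕ ∇ P)

  ¡ : ∀ P → Tape [] P
  ¡ []      = id₀
  ¡ (U ∷ P) = ¡₁ U ⊕ ¡ P

  -- Arrows of 𝒯(Diag PB) are tapes up to _≈_.
  infix 4 _≈_

  data _≈_ : ∀ {P Q} → Tape P Q → Tape P Q → Set (c ⊔ ℓ₁ ⊔ ℓ₂) where
    ≈-refl  : ∀ {P Q} {f : Tape P Q} → f ≈ f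
    ≈-sym   : ∀ {P Q} {f g : Tape P Q} → f ≈ g → g ≈ f
    ≈-trans : ∀ {P Q} {f g h : Tape P Q} → f ≈ g → g ≈ h → f ≈ h
    ⨾-cong  : ∀ {P Q R} {f f′ : Tape P Q} {g g′ : Tape Q R} → f ≈ f′ → g ≈ g′ → f ⨾ g ≈ f′ ⨾ g′
    ⊕-cong  : ∀ {P Q P′ Q′} {f f′ : Tape P Q} {g g′ : Tape P′ Q′} →
              f ≈ f′ → g ≈ g′ → f ⊕ g ≈ f′ ⊕ g′

    -- Equality of real numbers is a setoid equality, and elements of (0,1)
    -- carry proofs, so equal parameters have to be identified explicitly.
    Δ₁-cong : ∀ {p q} U → value p ≈ℝ value q → Δ₁ p U ≈ Δ₁ q U

    ⨾-assoc : ∀ {P Q R S} {f : Tape P Q} {g : Tape Q R} {h : Tape R S} →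
              (f ⨾ g) ⨾ h ≈ f ⨾ (g ⨾ h)
    ⨾-idˡ   : ∀ {P Q} {f : Tape P Q} → idᵗ P ⨾ f ≈ f
    ⨾-idʳ   : ∀ {P Q} {f : Tape P Q} → f ⨾ idᵗ Q ≈ f

    ⊕-id    : ∀ P Q → idᵗ P ⊕ idᵗ Q ≈ idᵗ (P ++ Q)
    ⊕-⨾     : ∀ {P Q R P′ Q′ R′} {f : Tape P Q} {g : Tape Q R} {f′ : Tape P′ Q′} {g′ : Tape Q′ R′} →
              (f ⨾ g) ⊕ (f′ ⨾ g′) ≈ (f ⊕ f′) ⨾ (g ⊕ g′)
    ⊕-assoc : ∀ {P Q P′ Q′ P″ Q″} {f : Tape P Q} {g : Tape P′ Q′} {h : Tape P″ Q″} →
              cast (++-assoc P P′ P″) (++-assoc Q Q′ Q″) ((f ⊕ g) ⊕ h) ≈ f ⊕ (g ⊕ h)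
    ⊕-unitˡ : ∀ {P Q} {f : Tape P Q} → id₀ ⊕ f ≈ f
    ⊕-unitʳ : ∀ {P Q} {f : Tape P Q} → cast (++-identityʳ P) (++-identityʳ Q) (f ⊕ id₀) ≈ f

    σ-natural : ∀ {P Q P′ Q′} {f : Tape P Q} {g : Tape P′ Q′} →
                (f ⊕ g) ⨾ σ⊕ Q Q′ ≈ σ⊕ P P′ ⨾ (g ⊕ f)
    σ-inverse : ∀ P Q → σ⊕ P Q ⨾ σ⊕ Q P ≈ idᵗ (P ++ Q)
    σ-hexagon : ∀ P Q R →
                cast (≡.sym (++-assoc P Q R)) (++-assoc Q R P) (σ⊕ P (Q ++ R)) ≈
                (σ⊕ P Q ⊕ idᵗ R) ⨾ cast (≡.sym (++-assoc Q P R)) ≡.refl (idᵗ Q ⊕ σ⊕ P R)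

    ⌜⌝-cong : ∀ {U V} {c d : Diag U V} → [ NoAxioms ] c ≈ d → ⌜ c ⌝ ≈ ⌜ d ⌝
    ⌜⌝-id   : ∀ U → ⌜ idᶜ U ⌝ ≈ id₁ U
    ⌜⌝-⨟    : ∀ {U V W} {c : Diag U V} {d : Diag V W} → ⌜ c ⨟ d ⌝ ≈ ⌜ c ⌝ ⨾ ⌜ d ⌝

    ∇-assoc : ∀ P → cast (++-assoc P P P) ≡.refl (∇ P ⊕ idᵗ P) ⨾ ∇ P ≈ (idᵗ P ⊕ ∇ P) ⨾ ∇ P
    ∇-unitˡ : ∀ P → (¡ P ⊕ idᵗ P) ⨾ ∇ P ≈ idᵗ P
    ∇-unitʳ : ∀ P → cast (++-identityʳ P) ≡.refl (idᵗ P ⊕ ¡ P) ⨾ ∇ P ≈ idᵗ P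
    ∇-comm  : ∀ P → σ⊕ P P ⨾ ∇ P ≈ ∇ P
    ∇-natural : ∀ {P Q} (f : Tape P Q) → ∇ P ⨾ f ≈ (f ⊕ f) ⨾ ∇ Q
    ¡-natural : ∀ {P Q} (f : Tape P Q) → ¡ P ⨾ f ≈ ¡ Q

    Δ-assoc   : ∀ p q P → Δ p P ⨾ (Δ q P ⊕ idᵗ P) ≈
                Δ (p *ᵖ q) P ⨾ cast ≡.refl (≡.sym (++-assoc P P P)) (idᵗ P ⊕ Δ (reassoc p q) P)
    Δ-comm    : ∀ p P → Δ p P ⨾ σ⊕ P P ≈ Δ (1- p) P
    Δ-idem    : ∀ p P → Δ p P ⨾ ∇ P ≈ idᵗ P
    Δ-natural : ∀ p {P Q} (f : Tape P Q) → f ⨾ Δ p Q ≈ Δ p P ⨾ (f ⊕ f)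
    !-natural : ∀ {P Q} (f : Tape P Q) → f ⨾ ! Q ≈ ! P

  δ : ∀ P Q R → Tape (P ⊗ᵒ (Q ++ R)) (P ⊗ᵒ Q ++ P ⊗ᵒ R)
  δ []      Q R = id₀
  δ (U ∷ P) Q R =
    (idᵗ (map (U +ℕ_) (Q ++ R)) ⊕ δ P Q R) ⨾
    cast (≡.trans (≡.sym (middle-assoc UQ UR (P ⊗ᵒ Q) (P ⊗ᵒ R)))
                  (cong (_++ (P ⊗ᵒ Q ++ P ⊗ᵒ R)) (≡.sym (map-++ (U +ℕ_) Q R))))
         (≡.sym (middle-assoc UQ (P ⊗ᵒ Q) UR (P ⊗ᵒ R)))
         (idᵗ UQ ⊕ σ⊕ UR (P ⊗ᵒ Q) ⊕ idᵗ (P ⊗ᵒ R))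
    where
    UQ = map (U +ℕ_) Q
    UR = map (U +ℕ_) R

  δ⁻¹ : ∀ P Q R → Tape (P ⊗ᵒ Q ++ P ⊗ᵒ R) (P ⊗ᵒ (Q ++ R))
  δ⁻¹ []      Q R = id₀
  δ⁻¹ (U ∷ P) Q R =
    cast (≡.sym (middle-assoc UQ (P ⊗ᵒ Q) UR (P ⊗ᵒ R)))
         (≡.trans (≡.sym (middle-assoc UQ UR (P ⊗ᵒ Q) (P ⊗ᵒ R)))
                  (cong (_++ (P ⊗ᵒ Q ++ P ⊗ᵒ R)) (≡.sym (map-++ (U +ℕ_) Q R))))
         (idᵗ UQ ⊕ σ⊕ (P ⊗ᵒ Q) UR ⊕ idᵗ (P ⊗ᵒ R)) ⨾
    (idᵗ (map (U +ℕ_) (Q ++ R)) ⊕ δ⁻¹ P Q R)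
    where
    UQ = map (U +ℕ_) Q
    UR = map (U +ℕ_) R

  L₁ : ∀ U {P Q} → Tape P Q → Tape (map (U +ℕ_) P) (map (U +ℕ_) Q)
  L₁ U (Δ₁ p V)  = Δ₁ p (U +ℕ V)
  L₁ U (!₁ V)    = !₁ (U +ℕ V)
  L₁ U (∇₁ V)    = ∇₁ (U +ℕ V)
  L₁ U (¡₁ V)    = ¡₁ (U +ℕ V)
  L₁ U ⌜ c ⌝     = ⌜ idᶜ U ⊗ c ⌝
  L₁ U (id₁ V)   = id₁ (U +ℕ V)
  L₁ U id₀       = id₀
  L₁ U (σ₁ V W)  = σ₁ (U +ℕ V) (U +ℕ W)
  L₁ U (f ⨾ g)   = L₁ U f ⨾ L₁ U g
  L₁ U (_⊕_ {P} {Q} {P′} {Q′} f g) =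
    cast (≡.sym (map-++ (U +ℕ_) P P′)) (≡.sym (map-++ (U +ℕ_) Q Q′)) (L₁ U f ⊕ L₁ U g)

  R₁ : ∀ U {P Q} → Tape P Q → Tape (P ⊗ᵒ (U ∷ [])) (Q ⊗ᵒ (U ∷ []))
  R₁ U (Δ₁ p V)  = Δ₁ p (V +ℕ U)
  R₁ U (!₁ V)    = !₁ (V +ℕ U)
  R₁ U (∇₁ V)    = ∇₁ (V +ℕ U)
  R₁ U (¡₁ V)    = ¡₁ (V +ℕ U)
  R₁ U ⌜ c ⌝     = ⌜ c ⊗ idᶜ U ⌝
  R₁ U (id₁ V)   = id₁ (V +ℕ U)
  R₁ U id₀       = id₀
  R₁ U (σ₁ V W)  = σ₁ (V +ℕ U) (W +ℕ U)
  R₁ U (f ⨾ g)   = R₁ U f ⨾ R₁ U g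
  R₁ U (_⊕_ {P} {Q} {P′} {Q′} f g) =
    cast (≡.sym (⊗ᵒ-distribʳ P P′ (U ∷ []))) (≡.sym (⊗ᵒ-distribʳ Q Q′ (U ∷ []))) (R₁ U f ⊕ R₁ U g)

  L : ∀ P {R S} → Tape R S → Tape (P ⊗ᵒ R) (P ⊗ᵒ S)
  L []      t = id₀
  L (U ∷ P) t = L₁ U t ⊕ L P t

  Rʷ : ∀ S {P Q} → Tape P Q → Tape (P ⊗ᵒ S) (Q ⊗ᵒ S)
  Rʷ []      {P} {Q} t = cast (≡.sym (⊗ᵒ-zeroʳ P)) (≡.sym (⊗ᵒ-zeroʳ Q)) id₀
  Rʷ (W ∷ S) {P} {Q} t = δ P (W ∷ []) S ⨾ (R₁ W t ⊕ Rʷ S t) ⨾ δ⁻¹ Q (W ∷ []) S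

  infixr 7 _⊗ᵗ_

  _⊗ᵗ_ : ∀ {P Q R S} → Tape P Q → Tape R S → Tape (P ⊗ᵒ R) (Q ⊗ᵒ S)
  _⊗ᵗ_ {P} {Q} {R} {S} t₁ t₂ = L P t₂ ⨾ Rʷ S t₁

  infix 6 _+[_]_
  infix 7 _·_

  _+[_]_ : ∀ {P Q} → Tape P Q → Prob → Tape P Q → Tape P Q
  _+[_]_ {P} {Q} f p g = Δ p P ⨾ (f ⊕ g) ⨾ ∇ Q

  ⋆ : ∀ P Q → Tape P Q
  ⋆ P Q = ! P ⨾ ¡ Q

  _·_ : ∀ {P Q} → Prob → Tape P Q → Tape P Q
  _·_ {P} {Q} p f = f +[ p ] ⋆ P Q

  infix 4 _∼̇_

  data _∼̇_ : ∀ {P Q} → Tape P Q → Tape P Q → Set (c ⊔ ℓ₁ ⊔ ℓ₂) where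
    incl    : ∀ {P Q} {f g : Tape P Q} → f ≈ g → f ∼̇ g
    ∼-sym   : ∀ {P Q} {f g : Tape P Q} → f ∼̇ g → g ∼̇ f
    ∼-trans : ∀ {P Q} {f g h : Tape P Q} → f ∼̇ g → g ∼̇ h → f ∼̇ h
    ⨾-cong  : ∀ {P Q R} {f f′ : Tape P Q} {g g′ : Tape Q R} → f ∼̇ f′ → g ∼̇ g′ → f ⨾ g ∼̇ f′ ⨾ g′
    ⊕-cong  : ∀ {P Q P′ Q′} {f f′ : Tape P Q} {g g′ : Tape P′ Q′} →
              f ∼̇ f′ → g ∼̇ g′ → f ⊕ g ∼̇ f′ ⊕ g′
    ⊗-cong  : ∀ {P Q P′ Q′} {f f′ : Tape P Q} {g g′ : Tape P′ Q′} →
              f ∼̇ f′ → g ∼̇ g′ → f ⊗ᵗ g ∼̇ f′ ⊗ᵗ g′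
    PB-eq   : ∀ {U V} {c d : Diag U V} → [ PBAxioms ] c ≈ d → ⌜ c ⌝ ∼̇ ⌜ d ⌝
    T1      : ⌜ fail ⌝ ∼̇ ⋆ (0 ∷ []) (1 ∷ [])
    T2      : ½ · id₁ 1 ∼̇ (⌜ test₁ ⌝ ⨾ ⌜ ttᶜ ⌝) +[ ½ ] (⌜ test₀ ⌝ ⨾ ⌜ ffᶜ ⌝)
    T3      : ∀ {P Q} {f g : Tape P Q} p → p · f ∼̇ p · g → f ∼̇ g

record FinSet : Set₁ where
  infix 4 _≟_
  field
    Carrier  : Set
    _≟_      : DecidableEquality Carrier
    elements : List Carrier
    unique   : Unique elements
    finite   : ∀ x → x ∈ elements

∣_∣ : FinSet → Set
∣_∣ = FinSet.Carrier

∅ : FinSet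
∅ = record
  { Carrier  = ⊥
  ; _≟_      = λ ()
  ; elements = []
  ; unique   = []
  ; finite   = λ ()
  }

infixr 6 _⊎ᶠ_

_⊎ᶠ_ : FinSet → FinSet → FinSet
X ⊎ᶠ Y = record
  { Carrier  = ∣ X ∣ ⊎ ∣ Y ∣
  ; _≟_      = ⊎-≡-dec X._≟_ Y._≟_
  ; elements = map inj₁ X.elements ++ map inj₂ Y.elements
  ; unique   = Unique.++⁺ (Unique.map⁺ inj₁-injective X.unique)
                          (Unique.map⁺ inj₂-injective Y.unique) disjoint
  ; finite   = λ { (inj₁ x) → ∈-++⁺ˡ (∈-map⁺ inj₁ (X.finite x))
                 ; (inj₂ y) → ∈-++⁺ʳ _ (∈-map⁺ inj₂ (Y.finite y)) }
  }
  where
  module X = FinSet X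
  module Y = FinSet Y
  disjoint : ∀ {v} → ¬ (v ∈ map inj₁ X.elements × v ∈ map inj₂ Y.elements)
  disjoint (p , q) with ∈-map⁻ inj₁ p | ∈-map⁻ inj₂ q
  ... | _ , _ , ≡.refl | _ , _ , ()

2^_ : ℕ → FinSet
2^ n = record
  { Carrier  = Vec Bool n
  ; _≟_      = Vec-≡-dec Bool._≟_
  ; elements = vectors n
  ; unique   = vectors-unique n
  ; finite   = vectors-finite
  }
  where
  vectors : ∀ n → List (Vec Bool n)
  vectors zero    = [] ∷ []
  vectors (suc n) = map (false ∷_) (vectors n) ++ map (true ∷_) (vectors n)

  vectors-unique : ∀ n → Unique (vectors n)
  vectors-unique zero    = [] ∷ []
  vectors-unique (suc n) =
    Unique.++⁺ (Unique.map⁺ ∷-injectiveʳ (vectors-unique n))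
               (Unique.map⁺ ∷-injectiveʳ (vectors-unique n)) disjoint
    where
    disjoint : ∀ {v} → ¬ (v ∈ map (false ∷_) (vectors n) × v ∈ map (true ∷_) (vectors n))
    disjoint (p , q) with ∈-map⁻ (false ∷_) p | ∈-map⁻ (true ∷_) q
    ... | _ , _ , ≡.refl | _ , _ , ()

  vectors-finite : ∀ {n} (v : Vec Bool n) → v ∈ vectors n
  vectors-finite []          = here ≡.refl
  vectors-finite (false ∷ v) = ∈-++⁺ˡ (∈-map⁺ (false ∷_) (vectors-finite v))
  vectors-finite (true ∷ v)  = ∈-++⁺ʳ _ (∈-map⁺ (true ∷_) (vectors-finite v))

⟦_⟧ᵒ : Objects → FinSet
⟦ [] ⟧ᵒ    = ∅
⟦ n ∷ P ⟧ᵒ = 2^ n ⊎ᶠ ⟦ P ⟧ᵒ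

split : ∀ P {Q} → ∣ ⟦ P ++ Q ⟧ᵒ ∣ → ∣ ⟦ P ⟧ᵒ ⊎ᶠ ⟦ Q ⟧ᵒ ∣
split []      y        = inj₂ y
split (n ∷ P) (inj₁ v) = inj₁ (inj₁ v)
split (n ∷ P) (inj₂ r) = Sum.map₁ inj₂ (split P r)

-- In particular, split is a bijection.
split-elements : ∀ P Q → map (split P) (FinSet.elements ⟦ P ++ Q ⟧ᵒ) ≡
                         FinSet.elements (⟦ P ⟧ᵒ ⊎ᶠ ⟦ Q ⟧ᵒ)
split-elements []      Q = ≡.refl
split-elements (n ∷ P) Q = begin
  map (split (n ∷ P)) (map inj₁ V ++ map inj₂ E)
    ≡⟨ map-++ (split (n ∷ P)) (map inj₁ V) (map inj₂ E) ⟩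
  map (split (n ∷ P)) (map inj₁ V) ++ map (split (n ∷ P)) (map inj₂ E)
    ≡⟨ cong₂ _++_ (≡.sym (map-∘ V)) (≡.sym (map-∘ E)) ⟩
  map (inj₁ ∘ inj₁) V ++ map (Sum.map₁ inj₂ ∘ split P) E
    ≡⟨ cong₂ _++_ (map-∘ V) (map-∘ E) ⟩
  map inj₁ (map inj₁ V) ++ map (Sum.map₁ inj₂) (map (split P) E)
    ≡⟨ cong (λ l → map inj₁ (map inj₁ V) ++ map (Sum.map₁ inj₂) l) (split-elements P Q) ⟩
  map inj₁ (map inj₁ V) ++ map (Sum.map₁ inj₂) (map inj₁ EP ++ map inj₂ EQ)
    ≡⟨ cong (map inj₁ (map inj₁ V) ++_) (map-++ (Sum.map₁ inj₂) (map inj₁ EP) (map inj₂ EQ)) ⟩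
  map inj₁ (map inj₁ V) ++ map (Sum.map₁ inj₂) (map inj₁ EP) ++ map (Sum.map₁ inj₂) (map inj₂ EQ)
    ≡⟨ cong (map inj₁ (map inj₁ V) ++_) (cong₂ _++_
         (≡.trans (≡.sym (map-∘ EP)) (map-∘ EP)) (≡.sym (map-∘ EQ))) ⟩
  map inj₁ (map inj₁ V) ++ map inj₁ (map inj₂ EP) ++ map inj₂ EQ
    ≡⟨ ++-assoc (map inj₁ (map inj₁ V)) _ _ ⟨
  (map inj₁ (map inj₁ V) ++ map inj₁ (map inj₂ EP)) ++ map inj₂ EQ
    ≡⟨ cong (_++ map inj₂ EQ) (map-++ inj₁ (map inj₁ V) (map inj₂ EP)) ⟨
  map inj₁ (map inj₁ V ++ map inj₂ EP) ++ map inj₂ EQ ∎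
  where
  open ≡.≡-Reasoning
  V  = FinSet.elements (2^ n)
  E  = FinSet.elements ⟦ P ++ Q ⟧ᵒ
  EP = FinSet.elements ⟦ P ⟧ᵒ
  EQ = FinSet.elements ⟦ Q ⟧ᵒ

module Subdistributions {c ℓ₁ ℓ₂} (R : Reals c ℓ₁ ℓ₂) where
  open Reals R hiding (Carrier)
  open Reals R using () renaming (Carrier to ℝ)
  open RealProperties R
  open OpenUnitInterval R
  open CommutativeRing commutativeRing using (+-commutativeSemigroup)
  open CommutativeSemigroupProperties +-commutativeSemigroup using (interchange)
  open SetoidReasoning setoid

  ∑ : ∀ {X : Set} → List X → (X → ℝ) → ℝ
  ∑ xs f = foldr (λ x s → f x + s) 0# xs

  module _ {X : Set} where

    ∑-cong : ∀ (xs : List X) {f g : X → ℝ} → (∀ x → f x ≈ g x) → ∑ xs f ≈ ∑ xs g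
    ∑-cong []       e = refl
    ∑-cong (x ∷ xs) e = +-cong (e x) (∑-cong xs e)

    ∑-mono : ∀ (xs : List X) {f g : X → ℝ} → (∀ x → f x ≤ g x) → ∑ xs f ≤ ∑ xs g
    ∑-mono []       e = ≤-refl
    ∑-mono (x ∷ xs) e = +-mono-≤ (e x) (∑-mono xs e)

    ∑-zero : ∀ (xs : List X) → ∑ xs (λ _ → 0#) ≈ 0#
    ∑-zero []       = refl
    ∑-zero (x ∷ xs) = trans (+-identityˡ _) (∑-zero xs)

    ∑-nonneg : ∀ (xs : List X) {f : X → ℝ} → (∀ x → 0# ≤ f x) → 0# ≤ ∑ xs f
    ∑-nonneg xs p = ≤-respˡ (∑-zero xs) (∑-mono xs p)

    ∑-+ : ∀ (xs : List X) (f g : X → ℝ) → ∑ xs (λ x → f x + g x) ≈ ∑ xs f + ∑ xs g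
    ∑-+ []       f g = sym (+-identityˡ 0#)
    ∑-+ (x ∷ xs) f g = trans (+-congˡ (∑-+ xs f g)) (interchange (f x) (g x) _ _)

    ∑-* : ∀ (xs : List X) a (f : X → ℝ) → ∑ xs (λ x → a * f x) ≈ a * ∑ xs f
    ∑-* []       a f = sym (zeroʳ a)
    ∑-* (x ∷ xs) a f = trans (+-congˡ (∑-* xs a f)) (sym (distribˡ a (f x) _))

    ∑-++ : ∀ (xs ys : List X) (f : X → ℝ) → ∑ (xs ++ ys) f ≈ ∑ xs f + ∑ ys f
    ∑-++ []       ys f = sym (+-identityˡ _)
    ∑-++ (x ∷ xs) ys f = trans (+-congˡ (∑-++ xs ys f)) (sym (Reals.+-assoc R (f x) _ _))

    ∑-map : ∀ {Y : Set} (h : X → Y) (xs : List X) (f : Y → ℝ) → ∑ (map h xs) f ≡ ∑ xs (f ∘ h)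
    ∑-map h []       f = ≡.refl
    ∑-map h (x ∷ xs) f = cong (f (h x) +_) (∑-map h xs f)

    ∑-swap : ∀ {Y : Set} (xs : List X) (ys : List Y) (f : X → Y → ℝ) →
             ∑ xs (λ x → ∑ ys (f x)) ≈ ∑ ys (λ y → ∑ xs (λ x → f x y))
    ∑-swap []       ys f = sym (zero′ ys)
      where
      zero′ : ∀ {Y : Set} (ys : List Y) → ∑ ys (λ _ → 0#) ≈ 0#
      zero′ []       = refl
      zero′ (y ∷ ys) = trans (+-identityˡ _) (zero′ ys)
    ∑-swap (x ∷ xs) ys f = trans (+-congˡ (∑-swap xs ys f)) (sym (plus ys))
      where
      plus : ∀ ys → ∑ ys (λ y → f x y + ∑ xs (λ x → f x y)) ≈
                    ∑ ys (f x) + ∑ ys (λ y → ∑ xs (λ x → f x y))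
      plus []       = sym (+-identityˡ 0#)
      plus (y ∷ ys) = trans (+-congˡ (plus ys)) (interchange _ _ _ _)

  -- On a finite set every d is finitely supported, and d(x) ≤ 1 follows from
  -- the two conditions.
  record 𝒟≤ (X : FinSet) : Set (c ⊔ ℓ₂) where
    open FinSet X
    field
      weight   : Carrier → ℝ
      weight≥0 : ∀ x → 0# ≤ weight x
      total≤1  : ∑ elements weight ≤ 1#

  open 𝒟≤ public

  𝟎 : ∀ {X} → 𝒟≤ X
  𝟎 {X} = record
    { weight   = λ _ → 0#
    ; weight≥0 = λ _ → ≤-refl
    ; total≤1  = ≤-respˡ (sym (∑-zero (FinSet.elements X))) (<⇒≤ 0<1)
    }

  dirac : ∀ {X} → ∣ X ∣ → 𝒟≤ X
  dirac {X} x = record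
    { weight   = w
    ; weight≥0 = w≥0
    ; total≤1  = ∑w≤1 unique
    }
    where
    open FinSet X
    w : Carrier → ℝ
    w y = if does (x ≟ y) then 1# else 0#
    w≥0 : ∀ y → 0# ≤ w y
    w≥0 y with x ≟ y
    ... | yes _ = <⇒≤ 0<1
    ... | no  _ = ≤-refl
    ∑w≈0 : ∀ {ys} → All (x ≢_) ys → ∑ ys w ≈ 0#
    ∑w≈0 []                  = refl
    ∑w≈0 {y ∷ _} (x≢y ∷ x≢ys) with x ≟ y
    ... | yes x≡y = ⊥-elim (x≢y x≡y)
    ... | no  _   = trans (+-identityˡ _) (∑w≈0 x≢ys)
    ∑w≤1 : ∀ {ys} → Unique ys → ∑ ys w ≤ 1#
    ∑w≤1 []                    = <⇒≤ 0<1
    ∑w≤1 {y ∷ _} (y≢ys ∷ uniq) with x ≟ y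
    ... | yes ≡.refl = ≤-respˡ (sym (trans (+-congˡ (∑w≈0 y≢ys)) (Reals.+-identityʳ R 1#))) ≤-refl
    ... | no  _      = ≤-respˡ (sym (+-identityˡ _)) (∑w≤1 uniq)

  mix : ∀ {X} → Prob → 𝒟≤ X → 𝒟≤ X → 𝒟≤ X
  mix {X} p d e = record
    { weight   = λ x → value p * weight d x + value (1- p) * weight e x
    ; weight≥0 = λ x → +-nonneg (*-nonneg (<⇒≤ (value>0 p)) (weight≥0 d x))
                                (*-nonneg (<⇒≤ (value>0 (1- p))) (weight≥0 e x))
    ; total≤1  = ≤-respˡ
        (sym (trans (∑-+ elements _ _) (+-cong (∑-* elements _ _) (∑-* elements _ _))))
        (≤-respʳ (trans (+-comm _ _) (x-z+z≈x 1# (value p)))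
          (+-mono-≤ (*-≤-factor (<⇒≤ (value>0 p)) (total≤1 d))
                    (*-≤-factor (<⇒≤ (value>0 (1- p))) (total≤1 e))))
    }
    where open FinSet X

  inl : ∀ {X Y} → 𝒟≤ X → 𝒟≤ (X ⊎ᶠ Y)
  inl {X} {Y} d = record
    { weight   = w
    ; weight≥0 = λ { (inj₁ x) → weight≥0 d x ; (inj₂ _) → ≤-refl }
    ; total≤1  = ≤-respˡ (sym (begin
        ∑ (map inj₁ X.elements ++ map inj₂ Y.elements) w
          ≈⟨ ∑-++ (map inj₁ X.elements) _ w ⟩
        ∑ (map inj₁ X.elements) w + ∑ (map inj₂ Y.elements) w
          ≡⟨ cong₂ _+_ (∑-map inj₁ X.elements w) (∑-map inj₂ Y.elements w) ⟩
        ∑ X.elements (weight d) + ∑ Y.elements (λ _ → 0#)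
          ≈⟨ trans (+-congˡ (∑-zero Y.elements)) (Reals.+-identityʳ R _) ⟩
        ∑ X.elements (weight d) ∎)) (total≤1 d)
    }
    where
    module X = FinSet X
    module Y = FinSet Y
    w : ∣ X ⊎ᶠ Y ∣ → ℝ
    w = [ weight d , (λ _ → 0#) ]′

  inr : ∀ {X Y} → 𝒟≤ Y → 𝒟≤ (X ⊎ᶠ Y)
  inr {X} {Y} d = record
    { weight   = w
    ; weight≥0 = λ { (inj₁ _) → ≤-refl ; (inj₂ y) → weight≥0 d y }
    ; total≤1  = ≤-respˡ (sym (begin
        ∑ (map inj₁ X.elements ++ map inj₂ Y.elements) w
          ≈⟨ ∑-++ (map inj₁ X.elements) _ w ⟩
        ∑ (map inj₁ X.elements) w + ∑ (map inj₂ Y.elements) w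
          ≡⟨ cong₂ _+_ (∑-map inj₁ X.elements w) (∑-map inj₂ Y.elements w) ⟩
        ∑ X.elements (λ _ → 0#) + ∑ Y.elements (weight d)
          ≈⟨ trans (+-congʳ (∑-zero X.elements)) (+-identityˡ _) ⟩
        ∑ Y.elements (weight d) ∎)) (total≤1 d)
    }
    where
    module X = FinSet X
    module Y = FinSet Y
    w : ∣ X ⊎ᶠ Y ∣ → ℝ
    w = [ (λ _ → 0#) , weight d ]′

  Kl : FinSet → FinSet → Set (c ⊔ ℓ₂)
  Kl X Y = ∣ X ∣ → 𝒟≤ Y

  infix 4 _≐_

  _≐_ : ∀ {X Y} → Kl X Y → Kl X Y → Set ℓ₁
  f ≐ g = ∀ x y → weight (f x) y ≈ weight (g x) y

  infixr 5 _⨾ₖ_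
  infixr 6 _⊕ₖ_

  _⨾ₖ_ : ∀ {X Y Z} → Kl X Y → Kl Y Z → Kl X Z
  _⨾ₖ_ {X} {Y} {Z} f g x = record
    { weight   = λ z → ∑ Y.elements (λ y → weight (f x) y * weight (g y) z)
    ; weight≥0 = λ z → ∑-nonneg Y.elements (λ y → *-nonneg (weight≥0 (f x) y) (weight≥0 (g y) z))
    ; total≤1  = ≤-trans
        (≤-respˡ (sym (trans (∑-swap Z.elements Y.elements _)
                             (∑-cong Y.elements (λ y → ∑-* Z.elements _ _))))
          (∑-mono Y.elements (λ y → *-≤-factor (weight≥0 (f x) y) (total≤1 (g y)))))
        (total≤1 (f x))
    }
    where
    module Y = FinSet Y
    module Z = FinSet Z

  _⊕ₖ_ : ∀ {X Y X′ Y′} → Kl X Y → Kl X′ Y′ → Kl (X ⊎ᶠ X′) (Y ⊎ᶠ Y′)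
  f ⊕ₖ g = [ inl ∘ f , inr ∘ g ]′

  J : ∀ {X Y} → (∣ X ∣ → Maybe ∣ Y ∣) → Kl X Y
  J f x = maybe′ dirac 𝟎 (f x)

  -- Transport along the bijection split : ⟦ Q ++ S ⟧ᵒ → ⟦ Q ⟧ᵒ ⊎ ⟦ S ⟧ᵒ.
  unsplit : ∀ Q S → 𝒟≤ (⟦ Q ⟧ᵒ ⊎ᶠ ⟦ S ⟧ᵒ) → 𝒟≤ ⟦ Q ++ S ⟧ᵒ
  unsplit Q S d = record
    { weight   = weight d ∘ split Q
    ; weight≥0 = weight≥0 d ∘ split Q
    ; total≤1  = ≤-respˡ (reflexive (≡.trans
        (cong (λ l → ∑ l (weight d)) (≡.sym (split-elements Q S)))
        (∑-map (split Q) (FinSet.elements ⟦ Q ++ S ⟧ᵒ) (weight d)))) (total≤1 d)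
    }

module Semantics {c ℓ₁ ℓ₂} (R : Reals c ℓ₁ ℓ₂) where
  open Tapes R
  open Subdistributions R

  ⟪_⟫ : ∀ {P Q} → Tape P Q → Kl ⟦ P ⟧ᵒ ⟦ Q ⟧ᵒ
  ⟪ Δ₁ p U ⟫        (inj₁ x)        = mix p (dirac (inj₁ x)) (dirac (inj₂ (inj₁ x)))
  ⟪ !₁ U ⟫          _               = 𝟎
  ⟪ ∇₁ U ⟫          (inj₁ x)        = dirac (inj₁ x)
  ⟪ ∇₁ U ⟫          (inj₂ (inj₁ x)) = dirac (inj₁ x)
  ⟪ ¡₁ U ⟫          ()
  ⟪ ⌜_⌝ {U} {V} c ⟫ (inj₁ x)        = inl (J {2^ U} {2^ V} ⟦ c ⟧ x)
  ⟪ id₁ U ⟫         x               = dirac x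
  ⟪ id₀ ⟫           ()
  ⟪ σ₁ U V ⟫        (inj₁ x)        = dirac (inj₂ (inj₁ x))
  ⟪ σ₁ U V ⟫        (inj₂ (inj₁ y)) = dirac (inj₁ y)
  ⟪ _⨾_ {P} {Q} {S} f g ⟫           = _⨾ₖ_ {⟦ P ⟧ᵒ} {⟦ Q ⟧ᵒ} {⟦ S ⟧ᵒ} ⟪ f ⟫ ⟪ g ⟫
  ⟪ _⊕_ {P} {Q} {P′} {Q′} f g ⟫ x   =
    unsplit Q Q′ (_⊕ₖ_ {⟦ P ⟧ᵒ} {⟦ Q ⟧ᵒ} {⟦ P′ ⟧ᵒ} {⟦ Q′ ⟧ᵒ} ⟪ f ⟫ ⟪ g ⟫ (split P x))

{-# OPTIONS --safe #-}
-- A tape f : P → Q is determined up to ∼̇ by its restrictions state x ⨾ f to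
-- the points x of P. For P = Aⁿ this is where T2 and T3 enter: T2 writes ½·id
-- on the first wire as a convex combination of tapes that factor through the
-- constants tt and ff, so tapes agreeing on both constants agree after scaling
-- by ½, and T3 removes the factor. For general P, ⊕ is a coproduct.
--
-- Restricted to a point, a tape becomes a convex combination of points of Q and
-- ⋆: a closed circuit evaluates in PB to a constant or, by T1, to ⋆. The
-- coefficients are those of the denotation, and in a convex algebra a convex
-- combination depends on its coefficients only.

module Submission where

open import Defs
open import Algebra.Bundles using (CommutativeSemigroup)
import Algebra.Properties.CommutativeSemigroup as CommutativeSemigroupProperties
open import Data.Bool using (Bool; true; false; if_then_else_)
open import Data.Empty using (⊥-elim)
open import Data.List using (List; []; _∷_; _++_; map; foldr)
open import Data.List.Membership.Propositional using (_∈_)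
open import Data.List.Membership.Propositional.Properties using (∈-map⁺)
open import Data.List.Properties using (++-assoc; ++-identityʳ)
open import Data.List.Relation.Unary.All as All using (All; []; _∷_)
import Data.List.Relation.Unary.All.Properties as All
open import Data.List.Relation.Unary.AllPairs using (_∷_)
open import Data.List.Relation.Unary.Any using (here; there)
open import Data.List.Relation.Unary.Unique.Propositional using (Unique)
import Data.List.Relation.Unary.Unique.Propositional.Properties as Unique
open import Data.Maybe as Maybe using (Maybe; just; nothing; maybe′)
open import Data.Maybe.Properties using (just-injective) renaming (≡-dec to Maybe-≡-dec)
open import Data.Maybe.Relation.Binary.Pointwise as Pointwise using (Pointwise; just; nothing)
open import Data.Nat using (zero; suc) renaming (_+_ to _+ℕ_)
open import Data.Product using (_×_; _,_; proj₁; proj₂; ∃-syntax; Σ-syntax)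
open import Data.Sum as Sum using (inj₁; inj₂)
open import Data.Sum.Properties using (inj₁-injective; inj₂-injective)
open import Data.Vec using (Vec; []; _∷_) renaming (_++_ to _++ᵛ_; take to takeᵛ; drop to dropᵛ)
open import Data.Vec.Properties using (take++drop≡id)
open import Function using (_∘_)
open import Level using (_⊔_) renaming (suc to lsuc)
open import Relation.Binary.Bundles using (Setoid)
open import Relation.Binary.Core using (Rel)
open import Relation.Binary.Definitions using (DecidableEquality)
open import Relation.Binary.PropositionalEquality as ≡ using (_≡_; _≢_)
import Relation.Binary.Reasoning.Setoid as SetoidReasoning
open import Relation.Binary.Structures using (IsEquivalence)
open import Relation.Nullary using (does; yes; no)

-- Two obstacles shape the argument. The order of the reals is not decidable, so a tree presenting a
-- denotation cannot be built by asking which weights vanish; the trees are read off the tapes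
-- instead, and weights are only compared at the end. Moreover, the trees of two tapes differ in
-- shape, and `+[ p ]` reassociates only with changed parameters; in the cone over a convex algebra
-- it becomes an associative and commutative sum with scalars, where leaves with the same label can
-- be collected. The tape `⋆` is an ordinary point there: its coefficient does not occur in the
-- denotation, but is what the other coefficients leave of 1.

-- Positive masses, and mixing parameters as ratios of masses

module PositiveReals {c ℓ₁ ℓ₂} (R : Reals c ℓ₁ ℓ₂) where
  open Reals R renaming (Carrier to ℝ)
  open RealProperties R
  open OpenUnitInterval R
  open SetoidReasoning setoid

  Pos : Set (c ⊔ ℓ₂)
  Pos = Σ[ r ∈ ℝ ] 0# < r

  +-pos : ∀ {x y} → 0# < x → 0# < y → 0# < x + y
  +-pos {x} p q = <-trans p (<-respˡ (Reals.+-identityʳ R x) (+-monoʳ-< x q))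

  infixl 6 _+⁺_
  infixl 7 _*⁺_

  _+⁺_ _*⁺_ : Pos → Pos → Pos
  (r , p) +⁺ (s , q) = r + s , +-pos p q
  (r , p) *⁺ (s , q) = r * s , *-pos p q

  1⁺ : Pos
  1⁺ = 1# , 0<1

  fromProb : Prob → Pos
  fromProb p = value p , value>0 p

  *-cancelʳ-pos : ∀ {x y} ((d , _) : Pos) → x * d ≈ y * d → x ≈ y
  *-cancelʳ-pos {x} {y} (d , 0<d) e = begin
    x                ≈⟨ *-identityʳ x ⟨
    x * 1#           ≈⟨ *-congˡ (1/-inverseʳ 0<d) ⟨
    x * (d * 1/ 0<d) ≈⟨ *-assoc x d _ ⟨
    x * d * 1/ 0<d   ≈⟨ *-congʳ e ⟩
    y * d * 1/ 0<d   ≈⟨ *-assoc y d _ ⟩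
    y * (d * 1/ 0<d) ≈⟨ *-congˡ (1/-inverseʳ 0<d) ⟩
    y * 1#           ≈⟨ *-identityʳ y ⟩
    y                ∎

  1/-inverseˡ : ∀ {x} (0<x : 0# < x) → 1/ 0<x * x ≈ 1#
  1/-inverseˡ 0<x = trans (*-comm _ _) (1/-inverseʳ 0<x)

  *-1/-cancel : ∀ x {d} (0<d : 0# < d) → x * 1/ 0<d * d ≈ x
  *-1/-cancel x 0<d = trans (*-assoc x _ _) (trans (*-congˡ (1/-inverseˡ 0<d)) (*-identityʳ x))

  -- If `x` is the share of `r` in the total `d`, then `1# - x` is the share of the rest `e`; shares
  -- are stated as products to avoid division.
  complement : ∀ {x d r e} → x * d ≈ r → r + e ≈ d → (1# - x) * d ≈ e
  complement {x} {d} {r} {e} xd r+e = begin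
    (1# - x) * d                        ≈⟨ x+z-z≈x _ r ⟨
    (1# - x) * d + r - r                ≈⟨ +-congʳ (+-congˡ xd) ⟨
    (1# - x) * d + x * d - r            ≈⟨ +-congʳ (distribʳ d _ x) ⟨
    (1# - x + x) * d - r                ≈⟨ +-congʳ (*-congʳ (x-z+z≈x 1# x)) ⟩
    1# * d - r                          ≈⟨ +-congʳ (*-identityˡ d) ⟩
    d - r                               ≈⟨ +-congʳ r+e ⟨
    r + e - r                           ≈⟨ +-congʳ (+-comm r e) ⟩
    e + r - r                           ≈⟨ x+z-z≈x e r ⟩
    e                                   ∎

  ratio : Pos → Pos → Prob
  ratio (r , 0<r) (s , 0<s) = record
    { value   = r * 1/ 0<r+s
    ; value>0 = *-pos 0<r (1/-pos 0<r+s)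
    ; value<1 = <-respˡ (*-comm _ _) (<-respʳ (1/-inverseˡ 0<r+s)
                  (*-monoˡ-< (1/-pos 0<r+s) (<-respˡ (Reals.+-identityʳ R r) (+-monoʳ-< r 0<s))))
    }
    where
    0<r+s : 0# < r + s
    0<r+s = +-pos 0<r 0<s

  ratio-* : ∀ u v → value (ratio u v) * proj₁ (u +⁺ v) ≈ proj₁ u
  ratio-* (r , 0<r) (s , 0<s) = *-1/-cancel r _

  -- The total mass is positive, hence cancellable. This reduces the identities between parameters
  -- below to equations without division.
  ratio-unique : ∀ {x} u v → x * proj₁ (u +⁺ v) ≈ proj₁ u → x ≈ value (ratio u v)
  ratio-unique u v e = *-cancelʳ-pos (u +⁺ v) (trans e (sym (ratio-* u v)))

  ratio-cong : ∀ u v u′ v′ → proj₁ u ≈ proj₁ u′ → proj₁ v ≈ proj₁ v′ →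
               value (ratio u v) ≈ value (ratio u′ v′)
  ratio-cong u v u′ v′ e f =
    ratio-unique u′ v′ (trans (*-congˡ (sym (+-cong e f))) (trans (ratio-* u v) e))

  ratio-comm : ∀ u v → value (1- (ratio u v)) ≈ value (ratio v u)
  ratio-comm u v =
    ratio-unique v u (trans (*-congˡ (+-comm _ _)) (complement (ratio-* u v) refl))

  ratio-scale : ∀ t u v → value (ratio (t *⁺ u) (t *⁺ v)) ≈ value (ratio u v)
  ratio-scale t u v = sym (ratio-unique (t *⁺ u) (t *⁺ v) (begin
    x * (proj₁ t * proj₁ u + proj₁ t * proj₁ v) ≈⟨ *-congˡ (distribˡ _ _ _) ⟨
    x * (proj₁ t * proj₁ (u +⁺ v))              ≈⟨ *-assoc x _ _ ⟨
    x * proj₁ t * proj₁ (u +⁺ v)                ≈⟨ *-congʳ (*-comm x _) ⟩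
    proj₁ t * x * proj₁ (u +⁺ v)                ≈⟨ *-assoc _ x _ ⟩
    proj₁ t * (x * proj₁ (u +⁺ v))              ≈⟨ *-congˡ (ratio-* u v) ⟩
    proj₁ t * proj₁ u                           ∎))
    where x = value (ratio u v)

  -- The factors `1⁺` match the parameter that arises in the cone when two points of height 1 are
  -- scaled by `p` and `1- p` and added.
  ratio-fromProb : ∀ p → value (ratio (fromProb p *⁺ 1⁺) (fromProb (1- p) *⁺ 1⁺)) ≈ value p
  ratio-fromProb p = sym (ratio-unique (fromProb p *⁺ 1⁺) (fromProb (1- p) *⁺ 1⁺)
    (trans (*-congˡ (trans (sym (distribʳ 1# _ _)) (*-congʳ p+1-p≈1)))
           (*-congˡ (*-identityˡ 1#))))
    where
    p+1-p≈1 : value p + value (1- p) ≈ 1#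
    p+1-p≈1 = trans (+-comm _ _) (x-z+z≈x 1# (value p))

  -- With the three masses r, s, t the parameters of Δ-assoc are ratios of masses.
  module _ (r s t : Pos) where
    private
      p = ratio (r +⁺ s) t
      q = ratio r s
      N = r +⁺ (s +⁺ t)

      p*N : value p * proj₁ N ≈ proj₁ (r +⁺ s)
      p*N = trans (*-congˡ (sym (Reals.+-assoc R _ _ _))) (ratio-* (r +⁺ s) t)

      pq*N : value (p *ᵖ q) * proj₁ N ≈ proj₁ r
      pq*N = begin
        value p * value q * proj₁ N   ≈⟨ *-congʳ (*-comm _ _) ⟩
        value q * value p * proj₁ N   ≈⟨ *-assoc _ _ _ ⟩
        value q * (value p * proj₁ N) ≈⟨ *-congˡ p*N ⟩
        value q * proj₁ (r +⁺ s)      ≈⟨ ratio-* r s ⟩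
        proj₁ r                       ∎

    ratio-*ᵖ : value (p *ᵖ q) ≈ value (ratio r (s +⁺ t))
    ratio-*ᵖ = ratio-unique r (s +⁺ t) pq*N

    ratio-reassoc : value (reassoc p q) ≈ value (ratio s t)
    -- The parameter is p(1-q)/(1-pq), and `s + t` is (1-pq)N. The denominator cancels, and (1-q)pN
    -- = (1-q)(r+s) = s remains.
    ratio-reassoc = ratio-unique s t (begin
      value (reassoc p q) * proj₁ (s +⁺ t)
        ≈⟨ *-congˡ (complement pq*N refl) ⟨
      value (reassoc p q) * ((1# - value (p *ᵖ q)) * proj₁ N)
        ≈⟨ *-assoc _ _ _ ⟨
      value (reassoc p q) * (1# - value (p *ᵖ q)) * proj₁ N
        ≈⟨ *-congʳ (*-1/-cancel _ (value>0 (1- (p *ᵖ q)))) ⟩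
      value p * (1# - value q) * proj₁ N
        ≈⟨ *-congʳ (*-comm _ _) ⟩
      (1# - value q) * value p * proj₁ N
        ≈⟨ *-assoc _ _ _ ⟩
      (1# - value q) * (value p * proj₁ N)
        ≈⟨ *-congˡ p*N ⟩
      (1# - value q) * proj₁ (r +⁺ s)
        ≈⟨ complement (ratio-* r s) refl ⟩
      proj₁ s ∎)

-- Convex algebras, their cones and barycentres

module Barycentric {c ℓ₁ ℓ₂} (R : Reals c ℓ₁ ℓ₂) where
  open Reals R renaming (Carrier to ℝ)
  open RealProperties R
  open OpenUnitInterval R
  open Subdistributions R using (∑; ∑-cong; ∑-+; ∑-*)
  open PositiveReals R

  -- Stone's barycentric algebras over a setoid, with parameters in the open interval.
  record ConvexAlgebra a ℓ : Set (lsuc (a ⊔ ℓ) ⊔ c ⊔ ℓ₁ ⊔ ℓ₂) where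
    field
      Carrier       : Set a
      _∼_           : Rel Carrier ℓ
      isEquivalence : IsEquivalence _∼_
      convex        : Prob → Carrier → Carrier → Carrier
      convex-cong   : ∀ {p q x x′ y y′} → value p ≈ value q → x ∼ x′ → y ∼ y′ →
                      convex p x y ∼ convex q x′ y′
      convex-idem   : ∀ p x → convex p x x ∼ x
      convex-comm   : ∀ p x y → convex p x y ∼ convex (1- p) y x
      convex-assoc  : ∀ p q x y z → convex p (convex q x y) z ∼
                                    convex (p *ᵖ q) x (convex (reassoc p q) y z)

  -- A non-negative real with a decision whether it vanishes, which the order of
  -- the reals does not provide constructively.
  Mass : Set (c ⊔ ℓ₂)
  Mass = Maybe Pos

  mass : Mass → ℝ
  mass (just (r , _)) = r
  mass nothing        = 0#

  infixl 6 _+ᵐ_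
  infixl 7 _*ᵐ_

  _+ᵐ_ : Mass → Mass → Mass
  just r  +ᵐ just s  = just (r +⁺ s)
  just r  +ᵐ nothing = just r
  nothing +ᵐ v       = v

  _*ᵐ_ : Pos → Mass → Mass
  r *ᵐ v = Maybe.map (r *⁺_) v

  mass-+ᵐ : ∀ u v → mass (u +ᵐ v) ≈ mass u + mass v
  mass-+ᵐ (just _) (just _) = refl
  mass-+ᵐ (just _) nothing  = sym (Reals.+-identityʳ R _)
  mass-+ᵐ nothing  v        = sym (+-identityˡ _)

  mass-*ᵐ : ∀ r v → mass (r *ᵐ v) ≈ proj₁ r * mass v
  mass-*ᵐ r (just _) = refl
  mass-*ᵐ r nothing  = sym (zeroʳ _)

  -- The terms of the theory of convex algebras with variables in `X`.
  data Tree {a} (X : Set a) : Set (a ⊔ c ⊔ ℓ₂) where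
    leaf : X → Tree X
    node : Prob → Tree X → Tree X → Tree X

  infixl 5 _>>=ᵗ_

  _>>=ᵗ_ : ∀ {a b} {X : Set a} {Y : Set b} → Tree X → (X → Tree Y) → Tree Y
  leaf x     >>=ᵗ k = k x
  node p D E >>=ᵗ k = node p (D >>=ᵗ k) (E >>=ᵗ k)

  module Weights {X : Set} (_≟_ : DecidableEquality X) where
    open SetoidReasoning setoid

    -- The value is `nothing` exactly when no leaf carries the point: whether a weight vanishes is
    -- read off the tree, not decided on reals.
    wt : Tree X → X → Mass
    wt (leaf x)     y = if does (x ≟ y) then just 1⁺ else nothing
    wt (node p D E) y = fromProb p *ᵐ wt D y +ᵐ fromProb (1- p) *ᵐ wt E y

    mass-leaf : ∀ x y → mass (wt (leaf x) y) ≈ (if does (x ≟ y) then 1# else 0#)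
    mass-leaf x y with x ≟ y
    ... | yes _ = refl
    ... | no  _ = refl

    mass-node : ∀ p D E y → mass (wt (node p D E) y) ≈
                value p * mass (wt D y) + value (1- p) * mass (wt E y)
    mass-node p D E y = trans
      (mass-+ᵐ (fromProb p *ᵐ wt D y) (fromProb (1- p) *ᵐ wt E y))
      (+-cong (mass-*ᵐ (fromProb p) (wt D y)) (mass-*ᵐ (fromProb (1- p)) (wt E y)))

    ∑-leaf-∉ : ∀ {x} (h : X → ℝ) {ys} → All (x ≢_) ys → ∑ ys (λ y → mass (wt (leaf x) y) * h y) ≈ 0#
    ∑-leaf-∉ h [] = refl
    ∑-leaf-∉ {x} h {y ∷ _} (x≢y ∷ x≢ys) with x ≟ y
    ... | yes x≡y = ⊥-elim (x≢y x≡y)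
    ... | no  _   = trans (+-cong (zeroˡ _) (∑-leaf-∉ h x≢ys)) (+-identityˡ _)

    ∑-leaf : ∀ {x} (h : X → ℝ) {ys} → Unique ys → x ∈ ys →
             ∑ ys (λ y → mass (wt (leaf x) y) * h y) ≈ h x
    ∑-leaf {x} h {y ∷ ys} (y≢ys ∷ uniq) x∈ with x ≟ y
    ... | yes ≡.refl =
      trans (+-cong (*-identityˡ _) (∑-leaf-∉ h y≢ys)) (Reals.+-identityʳ R _)
    ... | no  x≢y with x∈
    ...   | here x≡y   = ⊥-elim (x≢y x≡y)
    ...   | there x∈ys = trans (+-cong (zeroˡ _) (∑-leaf h uniq x∈ys)) (+-identityˡ _)

    module _ {ys : List X} (unique : Unique ys) (finite : ∀ x → x ∈ ys) where

      -- Together with `∑-wt-node` this computes the expectation of `h` by recursion on the tree.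
      -- Constant `h` gives the total mass, and the weights of a continuation give Kleisli
      -- composition.
      ∑-wt-leaf : ∀ x (h : X → ℝ) → ∑ ys (λ y → mass (wt (leaf x) y) * h y) ≈ h x
      ∑-wt-leaf x h = ∑-leaf h unique (finite x)

      ∑-wt-node : ∀ p D E (h : X → ℝ) → ∑ ys (λ y → mass (wt (node p D E) y) * h y) ≈
                  value p * ∑ ys (λ y → mass (wt D y) * h y) +
                  value (1- p) * ∑ ys (λ y → mass (wt E y) * h y)
      ∑-wt-node p D E h = begin
        ∑ ys (λ y → mass (wt (node p D E) y) * h y)
          ≈⟨ ∑-cong ys (λ y → trans (*-congʳ (mass-node p D E y)) (trans (distribʳ _ _ _)
               (+-cong (*-assoc _ _ _) (*-assoc _ _ _)))) ⟩
        ∑ ys (λ y → value p * (mass (wt D y) * h y) + value (1- p) * (mass (wt E y) * h y))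
          ≈⟨ trans (∑-+ ys _ _) (+-cong (∑-* ys _ _) (∑-* ys _ _)) ⟩
        value p * ∑ ys (λ y → mass (wt D y) * h y) +
        value (1- p) * ∑ ys (λ y → mass (wt E y) * h y) ∎

  -- The cone over a convex algebra: the origin nothing, and the points r·x
  -- with r > 0. A convex combination p x + (1 − p) y is a sum in the cone, so
  -- that sums over finite index lists are available there.
  module Cone {a ℓ} (A : ConvexAlgebra a ℓ) where
    open ConvexAlgebra A using (_∼_; convex; convex-cong; convex-idem; convex-comm; convex-assoc)
      renaming (Carrier to S)
    private module ∼ = IsEquivalence (ConvexAlgebra.isEquivalence A)

    C : Set (a ⊔ c ⊔ ℓ₂)
    C = Maybe (Pos × S)

    infix 4 _≋_
    infixl 6 _⊞_
    infixl 7 _⊡_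

    _≋_ : Rel C _
    _≋_ = Pointwise (λ (r , x) (s , y) → proj₁ r ≈ proj₁ s × x ∼ y)

    _⊞_ : C → C → C
    just (r , x) ⊞ just (s , y) = just (r +⁺ s , convex (ratio r s) x y)
    just u       ⊞ nothing      = just u
    nothing      ⊞ v            = v

    _⊡_ : Pos → C → C
    t ⊡ u = Maybe.map (λ (r , x) → t *⁺ r , x) u

    ≋-isEquivalence : IsEquivalence _≋_
    ≋-isEquivalence = Pointwise.isEquivalence record
      { refl  = refl , ∼.refl
      ; sym   = λ (e , f) → sym e , ∼.sym f
      ; trans = λ (e , f) (e′ , f′) → trans e e′ , ∼.trans f f′
      }

    ⊞-cong : ∀ {u u′ v v′} → u ≋ u′ → v ≋ v′ → u ⊞ v ≋ u′ ⊞ v′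
    ⊞-cong (just (e , f)) (just (e′ , f′)) =
      just (+-cong e e′ , convex-cong (ratio-cong _ _ _ _ e e′) f f′)
    ⊞-cong (just e) nothing = just e
    ⊞-cong nothing  e       = e

    ⊞-comm : ∀ u v → u ⊞ v ≋ v ⊞ u
    ⊞-comm (just (r , x)) (just (s , y)) = just (+-comm _ _ ,
      ∼.trans (convex-comm _ x y) (convex-cong (ratio-comm r s) ∼.refl ∼.refl))
    ⊞-comm (just _) nothing  = IsEquivalence.refl ≋-isEquivalence
    ⊞-comm nothing  (just _) = IsEquivalence.refl ≋-isEquivalence
    ⊞-comm nothing  nothing  = IsEquivalence.refl ≋-isEquivalence

    ⊞-assoc : ∀ u v w → (u ⊞ v) ⊞ w ≋ u ⊞ (v ⊞ w)
    ⊞-assoc (just (r , x)) (just (s , y)) (just (t , z)) = just (Reals.+-assoc R _ _ _ ,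
      ∼.trans (convex-assoc _ _ x y z)
        (convex-cong (ratio-*ᵖ r s t) ∼.refl
          (convex-cong (ratio-reassoc r s t) ∼.refl ∼.refl)))
    ⊞-assoc (just _) (just _) nothing = IsEquivalence.refl ≋-isEquivalence
    ⊞-assoc (just _) nothing  w       = IsEquivalence.refl ≋-isEquivalence
    ⊞-assoc nothing  v        w       = IsEquivalence.refl ≋-isEquivalence

    ⊞-commutativeSemigroup : CommutativeSemigroup _ _
    ⊞-commutativeSemigroup = record
      { Carrier = C ; _≈_ = _≋_ ; _∙_ = _⊞_
      ; isCommutativeSemigroup = record
        { isSemigroup = record
          { isMagma = record { isEquivalence = ≋-isEquivalence ; ∙-cong = ⊞-cong }
          ; assoc = ⊞-assoc
          }
        ; comm = ⊞-comm
        }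
      }

    private module C = CommutativeSemigroup ⊞-commutativeSemigroup
    open CommutativeSemigroupProperties ⊞-commutativeSemigroup using (interchange)
    open SetoidReasoning C.setoid

    ⊡-cong : ∀ t {u v} → u ≋ v → t ⊡ u ≋ t ⊡ v
    ⊡-cong t (just (e , f)) = just (*-congˡ e , f)
    ⊡-cong t nothing        = nothing

    ⊡-distrib-⊞ : ∀ t u v → t ⊡ (u ⊞ v) ≋ t ⊡ u ⊞ t ⊡ v
    ⊡-distrib-⊞ t (just (r , x)) (just (s , y)) = just (distribˡ _ _ _ ,
      convex-cong (sym (ratio-scale t r s)) ∼.refl ∼.refl)
    ⊡-distrib-⊞ t (just _) nothing = C.refl
    ⊡-distrib-⊞ t nothing  v       = C.refl

    -- The multiple of `x` by a mass, the origin for mass zero. Choosing between the two requires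
    -- the decision contained in `Mass`.
    tag : S → Mass → C
    tag x v = Maybe.map (_, x) v

    -- Additivity in the scalar is idempotence of convex combinations, read in the cone.
    tag-+ᵐ : ∀ x u v → tag x (u +ᵐ v) ≋ tag x u ⊞ tag x v
    tag-+ᵐ x (just r) (just s) = just (refl , ∼.sym (convex-idem _ x))
    tag-+ᵐ x (just r) nothing  = C.refl
    tag-+ᵐ x nothing  v        = C.refl

    tag-*ᵐ : ∀ x t v → tag x (t *ᵐ v) ≋ t ⊡ tag x v
    tag-*ᵐ x t (just r) = C.refl
    tag-*ᵐ x t nothing  = C.refl

    -- A positive real is not zero, so masses with equal values carry the same decision. Hence the
    -- real coefficients alone determine the multiple.
    tag-cong : ∀ x u v → mass u ≈ mass v → tag x u ≋ tag x v
    tag-cong x (just _)         (just _)         e = just (e , ∼.refl)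
    tag-cong x (just (_ , 0<r)) nothing          e = ⊥-elim (<-irrefl (sym e) 0<r)
    tag-cong x nothing          (just (_ , 0<s)) e = ⊥-elim (<-irrefl e 0<s)
    tag-cong x nothing          nothing          e = nothing

    ∑ᶜ : ∀ {X : Set} → List X → (X → C) → C
    ∑ᶜ ys f = foldr (λ y u → f y ⊞ u) nothing ys

    module _ {X : Set} where

      ∑ᶜ-cong : ∀ (ys : List X) {f g} → (∀ y → f y ≋ g y) → ∑ᶜ ys f ≋ ∑ᶜ ys g
      ∑ᶜ-cong []       e = C.refl
      ∑ᶜ-cong (y ∷ ys) e = ⊞-cong (e y) (∑ᶜ-cong ys e)

      ∑ᶜ-⊞ : ∀ (ys : List X) f g → ∑ᶜ ys (λ y → f y ⊞ g y) ≋ ∑ᶜ ys f ⊞ ∑ᶜ ys g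
      ∑ᶜ-⊞ []       f g = C.refl
      ∑ᶜ-⊞ (y ∷ ys) f g = C.trans (⊞-cong C.refl (∑ᶜ-⊞ ys f g)) (interchange (f y) (g y) _ _)

      ∑ᶜ-⊡ : ∀ (ys : List X) t f → ∑ᶜ ys (λ y → t ⊡ f y) ≋ t ⊡ ∑ᶜ ys f
      ∑ᶜ-⊡ []       t f = C.refl
      ∑ᶜ-⊡ (y ∷ ys) t f =
        C.trans (⊞-cong C.refl (∑ᶜ-⊡ ys t f)) (C.sym (⊡-distrib-⊞ t (f y) (∑ᶜ ys f)))

    module Evaluation {X : Set} (_≟_ : DecidableEquality X) (ρ : X → S) where
      open Weights _≟_

      eval : Tree X → S
      eval (leaf x)     = ρ x
      eval (node p D E) = convex p (eval D) (eval E)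

      private
        -- One summand for each point rather than for each leaf, so that the tree enters only
        -- through its weights.
        barycentre : List X → Tree X → C
        barycentre ys D = ∑ᶜ ys (λ y → tag (ρ y) (wt D y))

        barycentre-leaf-∉ : ∀ {x ys} → All (x ≢_) ys → barycentre ys (leaf x) ≋ nothing
        barycentre-leaf-∉ [] = C.refl
        barycentre-leaf-∉ {x} {y ∷ _} (x≢y ∷ x≢ys) with x ≟ y
        ... | yes x≡y = ⊥-elim (x≢y x≡y)
        ... | no  _   = barycentre-leaf-∉ x≢ys

        barycentre-leaf : ∀ {x ys} → Unique ys → x ∈ ys →
                          barycentre ys (leaf x) ≋ just (1⁺ , ρ x)
        barycentre-leaf {x} {y ∷ ys} (y≢ys ∷ uniq) x∈ with x ≟ y
        ... | yes ≡.refl = ⊞-cong C.refl (barycentre-leaf-∉ y≢ys)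
        ... | no  x≢y with x∈
        ...   | here x≡y   = ⊥-elim (x≢y x≡y)
        ...   | there x∈ys = barycentre-leaf uniq x∈ys

        barycentre-node : ∀ ys p D E → barycentre ys (node p D E) ≋
                          fromProb p ⊡ barycentre ys D ⊞ fromProb (1- p) ⊡ barycentre ys E
        barycentre-node ys p D E = begin
          barycentre ys (node p D E)
            ≈⟨ ∑ᶜ-cong ys (λ y → C.trans (tag-+ᵐ (ρ y) (fromProb p *ᵐ wt D y) _)
                 (⊞-cong (tag-*ᵐ (ρ y) _ (wt D y)) (tag-*ᵐ (ρ y) _ (wt E y)))) ⟩
          ∑ᶜ ys (λ y → fromProb p ⊡ tag (ρ y) (wt D y) ⊞ fromProb (1- p) ⊡ tag (ρ y) (wt E y))
            ≈⟨ ∑ᶜ-⊞ ys _ _ ⟩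
          ∑ᶜ ys (λ y → fromProb p ⊡ tag (ρ y) (wt D y)) ⊞
          ∑ᶜ ys (λ y → fromProb (1- p) ⊡ tag (ρ y) (wt E y))
            ≈⟨ ⊞-cong (∑ᶜ-⊡ ys _ _) (∑ᶜ-⊡ ys _ _) ⟩
          fromProb p ⊡ barycentre ys D ⊞ fromProb (1- p) ⊡ barycentre ys E ∎

      module _ {ys : List X} (unique : Unique ys) (finite : ∀ x → x ∈ ys) where

        -- At height 1 the combination with parameter `p` is the sum of the multiples by `p` and
        -- `1- p`, and these scalars distribute over the sum defining the barycentre.
        eval≋barycentre : ∀ D → just (1⁺ , eval D) ≋ barycentre ys D
        eval≋barycentre (leaf x)     = C.sym (barycentre-leaf unique (finite x))
        eval≋barycentre (node p D E) = begin
          just (1⁺ , convex p (eval D) (eval E))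
            ≈⟨ just (sym (trans (+-cong (*-identityʳ _) (*-identityʳ _))
                               (trans (+-comm _ _) (x-z+z≈x 1# (value p)))) ,
                     convex-cong (sym (ratio-fromProb p)) ∼.refl ∼.refl) ⟩
          fromProb p ⊡ just (1⁺ , eval D) ⊞ fromProb (1- p) ⊡ just (1⁺ , eval E)
            ≈⟨ ⊞-cong (⊡-cong _ (eval≋barycentre D)) (⊡-cong _ (eval≋barycentre E)) ⟩
          fromProb p ⊡ barycentre ys D ⊞ fromProb (1- p) ⊡ barycentre ys E
            ≈⟨ barycentre-node ys p D E ⟨
          barycentre ys (node p D E) ∎

        eval-cong : ∀ D E → (∀ y → mass (wt D y) ≈ mass (wt E y)) → eval D ∼ eval E
        -- Both ends have height 1, so their equality in the cone contains the equality in the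
        -- algebra.
        eval-cong D E e = proj₂ (Pointwise.drop-just (begin
          just (1⁺ , eval D) ≈⟨ eval≋barycentre D ⟩
          barycentre ys D    ≈⟨ ∑ᶜ-cong ys (λ y → tag-cong (ρ y) (wt D y) (wt E y) (e y)) ⟩
          barycentre ys E    ≈⟨ eval≋barycentre E ⟨
          just (1⁺ , eval E) ∎))

-- Evaluation of circuits on constants

module ClosedCircuits where

  infix 4 _≃_

  _≃_ : ∀ {n m} → Diag n m → Diag n m → Set
  c ≃ d = [ PBAxioms ] c ≈ d

  diagSetoid : ∀ n m → Setoid _ _
  diagSetoid n m = record
    { Carrier = Diag n m ; _≈_ = _≃_
    ; isEquivalence = record { refl = ≈-refl ; sym = ≈-sym ; trans = ≈-trans } }

  private open module Reasoning {n m} = SetoidReasoning (diagSetoid n m)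

  ⊗-⨟-cong : ∀ {n m k n′ m′ k′} {c : Diag n m} {d : Diag m k} {c′ : Diag n′ m′} {d′ : Diag m′ k′}
        {e : Diag n k} {e′ : Diag n′ k′} →
        (c ⨟ d) ≃ e → (c′ ⨟ d′) ≃ e′ → ((c ⊗ c′) ⨟ (d ⊗ d′)) ≃ (e ⊗ e′)
  ⊗-⨟-cong p q = ≈-trans (≈-sym ⊗-⨟) (⊗-cong p q)

  -- By the hexagon `σ 0 0` is idempotent, and an invertible idempotent is the identity.
  σ-unit : σ 0 0 ≃ idᶜ 0
  σ-unit = begin
    σ 0 0                                ≈⟨ ⨟-idʳ ⟨
    σ 0 0 ⨟ idᶜ 0                        ≈⟨ ⨟-cong ≈-refl (σ-inverse 0 0) ⟨
    σ 0 0 ⨟ (σ 0 0 ⨟ σ 0 0)              ≈⟨ ⨟-assoc ⟨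
    (σ 0 0 ⨟ σ 0 0) ⨟ σ 0 0              ≈⟨ ⨟-cong (⨟-cong ⊗-unitʳ ⊗-unitˡ) ≈-refl ⟨
    ((σ 0 0 ⊗ idᶜ 0) ⨟ (idᶜ 0 ⊗ σ 0 0)) ⨟ σ 0 0
                                         ≈⟨ ⨟-cong (σ-hexagon 0 0 0) ≈-refl ⟨
    σ 0 0 ⨟ σ 0 0                        ≈⟨ σ-inverse 0 0 ⟩
    idᶜ 0                                ∎

  ⊗-swap : ∀ {n m} (c : Diag 0 n) (d : Diag 0 m) → ((c ⊗ d) ⨟ σ n m) ≃ (d ⊗ c)
  ⊗-swap c d = ≈-trans σ-natural (≈-trans (⨟-cong σ-unit ≈-refl) ⨟-idˡ)

  bit : Bool → Diag 0 1
  bit true  = ttᶜ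
  bit false = ffᶜ

  const : ∀ {n} → Vec Bool n → Diag 0 n
  const []      = idᶜ 0
  const (b ∷ v) = bit b ⊗ const v

  const-[-] : ∀ b → const (b ∷ []) ≃ bit b
  const-[-] b = ⊗-unitʳ

  const₂ : ∀ a b → const (a ∷ b ∷ []) ≃ (bit a ⊗ bit b)
  const₂ a b = ⊗-cong ≈-refl (const-[-] b)

  const-++ : ∀ {n m} (v : Vec Bool n) (w : Vec Bool m) → const (v ++ᵛ w) ≃ (const v ⊗ const w)
  const-++ []      w = ≈-sym ⊗-unitˡ
  const-++ (b ∷ v) w = ≈-trans (⊗-cong ≈-refl (const-++ v w)) (≈-sym ⊗-assoc)

  const-take-drop : ∀ n {m} (v : Vec Bool (n +ℕ m)) →
                    const v ≃ (const (takeᵛ n v) ⊗ const (dropᵛ n v))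
  const-take-drop n v = ≈-trans
    (≡.subst (λ w → const v ≃ const w) (≡.sym (take++drop≡id n v)) ≈-refl)
    (const-++ (takeᵛ n v) (dropᵛ n v))

  -- Sequentialises a tensor so that `d` acts before anything else. This propagates the failure of
  -- `d`, and lets a first bit be prefixed to a constant on the remaining wires.
  ⊗-as-⨟ : ∀ {n m} (c : Diag 0 n) (d : Diag 0 m) → (c ⊗ d) ≃ (d ⨟ (c ⊗ idᶜ m))
  ⊗-as-⨟ c d = begin
    c ⊗ d                          ≈⟨ ⊗-cong ⨟-idˡ ⨟-idʳ ⟨
    (idᶜ 0 ⨟ c) ⊗ (d ⨟ idᶜ _)      ≈⟨ ⊗-⨟ ⟩
    (idᶜ 0 ⊗ d) ⨟ (c ⊗ idᶜ _)      ≈⟨ ⨟-cong ⊗-unitˡ ≈-refl ⟩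
    d ⨟ (c ⊗ idᶜ _)                ∎

  ff-¬ : (ffᶜ ⨟ ¬ᶜ) ≃ ttᶜ
  ff-¬ = ≈-trans ⨟-assoc (≈-trans (⨟-cong ≈-refl (axiom ¬-invol)) ⨟-idʳ)

  bit-copy : ∀ b → (bit b ⨟ copyᶜ) ≃ (bit b ⊗ bit b)
  bit-copy true  = axiom tt-copy
  bit-copy false = begin
    (ttᶜ ⨟ ¬ᶜ) ⨟ copyᶜ          ≈⟨ ⨟-assoc ⟩
    ttᶜ ⨟ (¬ᶜ ⨟ copyᶜ)          ≈⟨ ⨟-cong ≈-refl (axiom ¬-copy) ⟩
    ttᶜ ⨟ (copyᶜ ⨟ (¬ᶜ ⊗ ¬ᶜ))   ≈⟨ ⨟-assoc ⟨
    (ttᶜ ⨟ copyᶜ) ⨟ (¬ᶜ ⊗ ¬ᶜ)   ≈⟨ ⨟-cong (axiom tt-copy) ≈-refl ⟩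
    (ttᶜ ⊗ ttᶜ) ⨟ (¬ᶜ ⊗ ¬ᶜ)     ≈⟨ ⊗-⨟ ⟨
    ffᶜ ⊗ ffᶜ                   ∎

  bit-del : ∀ b → (bit b ⨟ delᶜ) ≃ idᶜ 0
  bit-del true  = axiom tt-del
  bit-del false = ≈-trans ⨟-assoc (≈-trans (⨟-cong ≈-refl (axiom ¬-del)) (axiom tt-del))

  -- An equal pair of bits is a copied bit. This serves both idempotence of `∧ᶜ` and the special law
  -- of `cocopyᶜ`.
  merge-copies : ∀ b {f : Diag 2 1} → (copyᶜ ⨟ f) ≃ idA → ((bit b ⊗ bit b) ⨟ f) ≃ bit b
  merge-copies b e = ≈-trans (⨟-cong (≈-sym (bit-copy b)) ≈-refl)
    (≈-trans ⨟-assoc (≈-trans (⨟-cong ≈-refl e) ⨟-idʳ))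

  tt-∧ : ∀ b → ((ttᶜ ⊗ bit b) ⨟ ∧ᶜ) ≃ bit b
  tt-∧ b = begin
    (ttᶜ ⊗ bit b) ⨟ ∧ᶜ                      ≈⟨ ⨟-cong (⊗-cong ⨟-idˡ ⨟-idʳ) ≈-refl ⟨
    ((idᶜ 0 ⨟ ttᶜ) ⊗ (bit b ⨟ idA)) ⨟ ∧ᶜ    ≈⟨ ⨟-cong ⊗-⨟ ≈-refl ⟩
    ((idᶜ 0 ⊗ bit b) ⨟ (ttᶜ ⊗ idA)) ⨟ ∧ᶜ    ≈⟨ ⨟-assoc ⟩
    (idᶜ 0 ⊗ bit b) ⨟ ((ttᶜ ⊗ idA) ⨟ ∧ᶜ)    ≈⟨ ⨟-cong ⊗-unitˡ (axiom ∧-unitˡ) ⟩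
    bit b ⨟ idA                             ≈⟨ ⨟-idʳ ⟩
    bit b                                   ∎

  swap-bits : ∀ a b {f : Diag 2 1} → (σA ⨟ f) ≃ f → ((bit a ⊗ bit b) ⨟ f) ≃ ((bit b ⊗ bit a) ⨟ f)
  swap-bits a b {f} e = begin
    (bit a ⊗ bit b) ⨟ f              ≈⟨ ⨟-cong ≈-refl e ⟨
    (bit a ⊗ bit b) ⨟ (σA ⨟ f)       ≈⟨ ⨟-assoc ⟨
    ((bit a ⊗ bit b) ⨟ σA) ⨟ f       ≈⟨ ⨟-cong (⊗-swap (bit a) (bit b)) ≈-refl ⟩
    (bit b ⊗ bit a) ⨟ f              ∎

  const-gen : ∀ {n m} (g : PB n m) v {w} → ⟦ g ⟧ᵍ v ≡ just w → (const v ⨟ gen g) ≃ const w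
  const-gen and (true ∷ b ∷ []) ≡.refl =
    ≈-trans (⨟-cong (const₂ true b) ≈-refl) (≈-trans (tt-∧ b) (≈-sym (const-[-] b)))
  const-gen and (false ∷ true ∷ []) ≡.refl = ≈-trans (⨟-cong (const₂ false true) ≈-refl)
    (≈-trans (swap-bits false true (axiom ∧-comm)) (≈-trans (tt-∧ false) (≈-sym (const-[-] false))))
  const-gen and (false ∷ false ∷ []) ≡.refl = ≈-trans (⨟-cong (const₂ false false) ≈-refl)
    (≈-trans (merge-copies false (axiom ∧-idem)) (≈-sym (const-[-] false)))
  const-gen neg (true ∷ []) ≡.refl =
    ≈-trans (⨟-cong (const-[-] true) ≈-refl) (≈-sym (const-[-] false))
  const-gen neg (false ∷ []) ≡.refl =
    ≈-trans (⨟-cong (const-[-] false) ≈-refl) (≈-trans ff-¬ (≈-sym (const-[-] true)))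
  const-gen tt [] ≡.refl = ≈-trans ⨟-idˡ (≈-sym (const-[-] true))
  const-gen copy (b ∷ []) ≡.refl =
    ≈-trans (⨟-cong (const-[-] b) ≈-refl) (≈-trans (bit-copy b) (≈-sym (const₂ b b)))
  const-gen del (b ∷ []) ≡.refl = ≈-trans (⨟-cong (const-[-] b) ≈-refl) (bit-del b)
  const-gen cocopy (true ∷ true ∷ []) ≡.refl = ≈-trans (⨟-cong (const₂ true true) ≈-refl)
    (≈-trans (merge-copies true (axiom special)) (≈-sym (const-[-] true)))
  const-gen cocopy (false ∷ false ∷ []) ≡.refl = ≈-trans (⨟-cong (const₂ false false) ≈-refl)
    (≈-trans (merge-copies false (axiom special)) (≈-sym (const-[-] false)))

  const-cocopy-fail : ∀ v → ⟦ cocopy ⟧ᵍ v ≡ nothing → (const v ⨟ cocopyᶜ) ≃ fail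
  const-cocopy-fail (true ∷ false ∷ []) _ = ⨟-cong (const₂ true false) ≈-refl
  const-cocopy-fail (false ∷ true ∷ []) _ = ≈-trans (⨟-cong (const₂ false true) ≈-refl)
    (swap-bits false true (axiom cocopy-comm))

  -- Induction on the circuit, cutting the constant at the boundary of a tensor. A defined value
  -- leaves no failing subcircuit, so this happens within PB; failure is treated in `const-fail`.
  const-⨟ : ∀ {n m} (c : Diag n m) v {w} → ⟦ c ⟧ v ≡ just w → (const v ⨟ c) ≃ const w
  const-⨟ (gen g) v e = const-gen g v e
  const-⨟ (idᶜ n) v ≡.refl = ⨟-idʳ
  const-⨟ (σ n m) v ≡.refl = begin
    const v ⨟ σ n m                                         ≈⟨ ⨟-cong (const-take-drop n v) ≈-refl ⟩
    (const (takeᵛ n v) ⊗ const (dropᵛ n v)) ⨟ σ n m         ≈⟨ ⊗-swap _ _ ⟩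
    const (dropᵛ n v) ⊗ const (takeᵛ n v)                   ≈⟨ const-++ (dropᵛ n v) (takeᵛ n v) ⟨
    const (dropᵛ n v ++ᵛ takeᵛ n v)                         ∎
  const-⨟ (c ⨟ d) v e with ⟦ c ⟧ v in eq
  ... | just w = ≈-trans (≈-sym ⨟-assoc) (≈-trans (⨟-cong (const-⨟ c v eq) ≈-refl) (const-⨟ d w e))
  const-⨟ (_⊗_ {n = n} c d) v e with ⟦ c ⟧ (takeᵛ n v) in eq | ⟦ d ⟧ (dropᵛ n v) in eq′
  const-⨟ (_⊗_ {n = n} c d) v ≡.refl | just w | just w′ = begin
    const v ⨟ (c ⊗ d)                                        ≈⟨ ⨟-cong (const-take-drop n v) ≈-refl ⟩
    (const (takeᵛ n v) ⊗ const (dropᵛ n v)) ⨟ (c ⊗ d)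
      ≈⟨ ⊗-⨟-cong (const-⨟ c _ eq) (const-⨟ d _ eq′) ⟩
    const w ⊗ const w′                                       ≈⟨ const-++ w w′ ⟨
    const (w ++ᵛ w′)                                         ∎

-- Convex structure and coproducts of tapes

module TapeLaws {c ℓ₁ ℓ₂} (R : Reals c ℓ₁ ℓ₂) where
  open Reals R using () renaming (_≈_ to _≈ℝ_)
  open OpenUnitInterval R
  open Tapes R

  tapeSetoid : Objects → Objects → Setoid _ _
  tapeSetoid P Q = record
    { Carrier = Tape P Q ; _≈_ = _≈_
    ; isEquivalence = record { refl = ≈-refl ; sym = ≈-sym ; trans = ≈-trans } }

  private open module Reasoning {P Q} = SetoidReasoning (tapeSetoid P Q)

  private
    variable
      P P′ Q Q′ S S′ : Objects

  cast-⨾ : ∀ (p : P ≡ P′) (q : Q ≡ Q′) (s : S ≡ S′) {f : Tape P Q} {g : Tape Q S} →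
           cast p q f ⨾ cast q s g ≡ cast p s (f ⨾ g)
  cast-⨾ ≡.refl ≡.refl ≡.refl = ≡.refl

  cast-flip : ∀ (p : P ≡ P′) (q : Q ≡ Q′) {f : Tape P Q} {g : Tape P′ Q′} →
              cast p q f ≈ g → f ≈ cast (≡.sym p) (≡.sym q) g
  cast-flip ≡.refl ≡.refl e = e

  ⊕-castʳ : ∀ (q : Q ≡ Q′) {f : Tape P S} {g : Tape P′ Q} →
            f ⊕ cast ≡.refl q g ≡ cast ≡.refl (≡.cong (S ++_) q) (f ⊕ g)
  ⊕-castʳ ≡.refl = ≡.refl

  ⊕-⨾-cong : {f : Tape P Q} {g : Tape Q S} {f′ : Tape P′ Q′} {g′ : Tape Q′ S′}
             {h : Tape P S} {h′ : Tape P′ S′} →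
             f ⨾ g ≈ h → f′ ⨾ g′ ≈ h′ → (f ⊕ f′) ⨾ (g ⊕ g′) ≈ h ⊕ h′
  ⊕-⨾-cong e e′ = ≈-trans (≈-sym ⊕-⨾) (⊕-cong e e′)

  idᵗ-[-] : ∀ U → idᵗ (U ∷ []) ≈ id₁ U
  idᵗ-[-] U = ⊕-unitʳ

  id₁-⨾ : ∀ {U} {f : Tape (U ∷ []) Q} → id₁ U ⨾ f ≈ f
  id₁-⨾ = ≈-trans (⨾-cong (≈-sym (idᵗ-[-] _)) ≈-refl) ⨾-idˡ

  ⨾-id₁ : ∀ {U} {f : Tape P (U ∷ [])} → f ⨾ id₁ U ≈ f
  ⨾-id₁ = ≈-trans (⨾-cong ≈-refl (≈-sym (idᵗ-[-] _))) ⨾-idʳ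

  σ⊕-unitʳ : ∀ U → σ⊕ (U ∷ []) [] ≈ id₁ U
  σ⊕-unitʳ U = ≈-trans (⨾-cong (idᵗ-[-] U) (idᵗ-[-] U)) id₁-⨾

  -- The laws of tapes concern the extensions to lists, whereas terms are built from the generators;
  -- on a single word the two differ by units only.
  Δ-[-] : ∀ p U → Δ p (U ∷ []) ≈ Δ₁ p U
  Δ-[-] p U = ≈-trans
    (⨾-cong ⊕-unitʳ (⊕-cong ≈-refl (⊕-cong (σ⊕-unitʳ U) ≈-refl)))
    ⨾-idʳ

  ∇-[-] : ∀ U → ∇ (U ∷ []) ≈ ∇₁ U
  ∇-[-] U = ≈-trans
    (⨾-cong (⊕-cong ≈-refl ⊕-unitʳ) ⊕-unitʳ)
    ⨾-idˡ

  !-[-] : ∀ U → ! (U ∷ []) ≈ !₁ U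
  !-[-] U = ⊕-unitʳ

  ¡-[-] : ∀ U → ¡ (U ∷ []) ≈ ¡₁ U
  ¡-[-] U = ⊕-unitʳ

  σ⊕-[-] : ∀ U V → σ⊕ (U ∷ []) (V ∷ []) ≈ σ₁ U V
  σ⊕-[-] U V = begin
    (id₁ U ⊕ idᵗ (V ∷ [])) ⨾ (((σ₁ U V ⊕ id₀) ⨾ (id₁ V ⊕ id₁ U)) ⊕ id₀) ≈⟨ ⨾-idˡ ⟩
    ((σ₁ U V ⊕ id₀) ⨾ (id₁ V ⊕ id₁ U)) ⊕ id₀ ≈⟨ ⊕-unitʳ ⟩
    (σ₁ U V ⊕ id₀) ⨾ (id₁ V ⊕ id₁ U) ≈⟨ ⨾-cong ⊕-unitʳ (⊕-cong ≈-refl (≈-sym (idᵗ-[-] U))) ⟩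
    σ₁ U V ⨾ idᵗ (V ∷ U ∷ []) ≈⟨ ⨾-idʳ ⟩
    σ₁ U V ∎

  Δ-cong : ∀ {p q} P → value p ≈ℝ value q → Δ p P ≈ Δ q P
  Δ-cong []      e = ≈-refl
  Δ-cong (U ∷ P) e = ⨾-cong (⊕-cong (Δ₁-cong U e) (Δ-cong P e)) ≈-refl

  ⋆-⨾ : (f : Tape Q S) → ⋆ P Q ⨾ f ≈ ⋆ P S
  ⋆-⨾ f = ≈-trans ⨾-assoc (⨾-cong ≈-refl (¡-natural f))

  +-⨾ : ∀ p (f g : Tape P Q) (h : Tape Q S) → (f +[ p ] g) ⨾ h ≈ (f ⨾ h) +[ p ] (g ⨾ h)
  +-⨾ {P} {Q} {S} p f g h = begin
    (Δ p P ⨾ (f ⊕ g) ⨾ ∇ Q) ⨾ h        ≈⟨ ≈-trans ⨾-assoc (⨾-cong ≈-refl ⨾-assoc) ⟩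
    Δ p P ⨾ (f ⊕ g) ⨾ ∇ Q ⨾ h          ≈⟨ ⨾-cong ≈-refl (⨾-cong ≈-refl (∇-natural h)) ⟩
    Δ p P ⨾ (f ⊕ g) ⨾ (h ⊕ h) ⨾ ∇ S    ≈⟨ ⨾-cong ≈-refl ⨾-assoc ⟨
    Δ p P ⨾ ((f ⊕ g) ⨾ (h ⊕ h)) ⨾ ∇ S  ≈⟨ ⨾-cong ≈-refl (⨾-cong ⊕-⨾ ≈-refl) ⟨
    Δ p P ⨾ ((f ⨾ h) ⊕ (g ⨾ h)) ⨾ ∇ S  ∎

  +-idem : ∀ p (f : Tape P Q) → f +[ p ] f ≈ f
  +-idem {P} {Q} p f = begin
    Δ p P ⨾ (f ⊕ f) ⨾ ∇ Q   ≈⟨ ⨾-assoc ⟨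
    (Δ p P ⨾ (f ⊕ f)) ⨾ ∇ Q ≈⟨ ⨾-cong (Δ-natural p f) ≈-refl ⟨
    (f ⨾ Δ p Q) ⨾ ∇ Q       ≈⟨ ⨾-assoc ⟩
    f ⨾ Δ p Q ⨾ ∇ Q         ≈⟨ ⨾-cong ≈-refl (Δ-idem p Q) ⟩
    f ⨾ idᵗ Q               ≈⟨ ⨾-idʳ ⟩
    f                       ∎

  +-comm : ∀ p (f g : Tape P Q) → f +[ p ] g ≈ g +[ 1- p ] f
  +-comm {P} {Q} p f g = begin
    Δ p P ⨾ (f ⊕ g) ⨾ ∇ Q              ≈⟨ ⨾-cong ≈-refl (⨾-cong ≈-refl (∇-comm Q)) ⟨
    Δ p P ⨾ (f ⊕ g) ⨾ σ⊕ Q Q ⨾ ∇ Q     ≈⟨ ⨾-cong ≈-refl ⨾-assoc ⟨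
    Δ p P ⨾ ((f ⊕ g) ⨾ σ⊕ Q Q) ⨾ ∇ Q   ≈⟨ ⨾-cong ≈-refl (⨾-cong σ-natural ≈-refl) ⟩
    Δ p P ⨾ (σ⊕ P P ⨾ (g ⊕ f)) ⨾ ∇ Q   ≈⟨ ⨾-cong ≈-refl ⨾-assoc ⟩
    Δ p P ⨾ σ⊕ P P ⨾ (g ⊕ f) ⨾ ∇ Q     ≈⟨ ⨾-assoc ⟨
    (Δ p P ⨾ σ⊕ P P) ⨾ (g ⊕ f) ⨾ ∇ Q   ≈⟨ ⨾-cong (Δ-comm p P) ≈-refl ⟩
    Δ (1- p) P ⨾ (g ⊕ f) ⨾ ∇ Q         ∎

  -- Padding `h` with identities exposes one threefold sum of `f`, `g`, `h`, with `Δ-assoc` to apply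
  -- before it and `∇-assoc` after it. The casts compare the two bracketings and cancel.
  +-assoc : ∀ p q (f g h : Tape P Q) →
            (f +[ q ] g) +[ p ] h ≈ f +[ p *ᵖ q ] (g +[ reassoc p q ] h)
  +-assoc {P} {Q} p q f g h = begin
    Δ p P ⨾ ((Δ q P ⨾ (f ⊕ g) ⨾ ∇ Q) ⊕ h) ⨾ ∇ Q
      ≈⟨ ⨾-cong ≈-refl (⨾-cong (⊕-cong ≈-refl (≈-trans (⨾-cong ≈-refl ⨾-idʳ) ⨾-idˡ)) ≈-refl) ⟨
    Δ p P ⨾ ((Δ q P ⨾ (f ⊕ g) ⨾ ∇ Q) ⊕ (idᵗ P ⨾ h ⨾ idᵗ Q)) ⨾ ∇ Q
      ≈⟨ ⨾-cong ≈-refl (⨾-cong (≈-trans ⊕-⨾ (⨾-cong ≈-refl ⊕-⨾)) ≈-refl) ⟩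
    Δ p P ⨾ ((Δ q P ⊕ idᵗ P) ⨾ ((f ⊕ g) ⊕ h) ⨾ (∇ Q ⊕ idᵗ Q)) ⨾ ∇ Q
      ≈⟨ ⨾-cong ≈-refl (≈-trans ⨾-assoc (⨾-cong ≈-refl ⨾-assoc)) ⟩
    Δ p P ⨾ (Δ q P ⊕ idᵗ P) ⨾ ((f ⊕ g) ⊕ h) ⨾ (∇ Q ⊕ idᵗ Q) ⨾ ∇ Q
      ≈⟨ ≈-trans (≈-sym ⨾-assoc) (⨾-cong (Δ-assoc p q P) ≈-refl) ⟩
    (Δ (p *ᵖ q) P ⨾ cast ≡.refl (≡.sym aP) (idᵗ P ⊕ Δ r P)) ⨾ ((f ⊕ g) ⊕ h) ⨾ (∇ Q ⊕ idᵗ Q) ⨾ ∇ Q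
      ≈⟨ ⨾-assoc ⟩
    Δ (p *ᵖ q) P ⨾ cast ≡.refl (≡.sym aP) (idᵗ P ⊕ Δ r P) ⨾ ((f ⊕ g) ⊕ h) ⨾ (∇ Q ⊕ idᵗ Q) ⨾ ∇ Q
      ≈⟨ ⨾-cong ≈-refl (⨾-cong ≈-refl (⨾-cong (cast-flip aP aQ ⊕-assoc) ∇∇)) ⟩
    Δ (p *ᵖ q) P ⨾ cast ≡.refl (≡.sym aP) (idᵗ P ⊕ Δ r P) ⨾
      cast (≡.sym aP) (≡.sym aQ) (f ⊕ g ⊕ h) ⨾ cast (≡.sym aQ) ≡.refl ((idᵗ Q ⊕ ∇ Q) ⨾ ∇ Q)
      ≡⟨ ≡.cong (λ x → Δ (p *ᵖ q) P ⨾ x) (≡.trans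
           (≡.cong (cast ≡.refl (≡.sym aP) (idᵗ P ⊕ Δ r P) ⨾_) (cast-⨾ (≡.sym aP) (≡.sym aQ) ≡.refl))
           (cast-⨾ ≡.refl (≡.sym aP) ≡.refl)) ⟩
    Δ (p *ᵖ q) P ⨾ (idᵗ P ⊕ Δ r P) ⨾ (f ⊕ g ⊕ h) ⨾ (idᵗ Q ⊕ ∇ Q) ⨾ ∇ Q
      ≈⟨ ⨾-cong ≈-refl (≈-trans (⨾-cong ≈-refl (≈-sym ⨾-assoc)) (≈-sym ⨾-assoc)) ⟩
    Δ (p *ᵖ q) P ⨾ ((idᵗ P ⊕ Δ r P) ⨾ (f ⊕ g ⊕ h) ⨾ (idᵗ Q ⊕ ∇ Q)) ⨾ ∇ Q
      ≈⟨ ⨾-cong ≈-refl (⨾-cong (⨾-cong ≈-refl (⊕-⨾-cong ⨾-idʳ ≈-refl)) ≈-refl) ⟩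
    Δ (p *ᵖ q) P ⨾ ((idᵗ P ⊕ Δ r P) ⨾ (f ⊕ ((g ⊕ h) ⨾ ∇ Q))) ⨾ ∇ Q
      ≈⟨ ⨾-cong ≈-refl (⨾-cong (⊕-⨾-cong ⨾-idˡ ≈-refl) ≈-refl) ⟩
    Δ (p *ᵖ q) P ⨾ (f ⊕ (Δ r P ⨾ (g ⊕ h) ⨾ ∇ Q)) ⨾ ∇ Q ∎
    where
    r  = reassoc p q
    aP = ++-assoc P P P
    aQ = ++-assoc Q Q Q
    ∇∇ : (∇ Q ⊕ idᵗ Q) ⨾ ∇ Q ≈ cast (≡.sym aQ) ≡.refl ((idᵗ Q ⊕ ∇ Q) ⨾ ∇ Q)
    ∇∇ = cast-flip aQ ≡.refl (≈-trans
      (≡.subst (λ x → x ≈ cast aQ ≡.refl (∇ Q ⊕ idᵗ Q) ⨾ ∇ Q) (cast-⨾ aQ ≡.refl ≡.refl) ≈-refl)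
      (∇-assoc Q))

  ι₁ : ∀ P Q → Tape P (P ++ Q)
  ι₁ P Q = cast (++-identityʳ P) ≡.refl (idᵗ P ⊕ ¡ Q)

  ι₂ : ∀ P Q → Tape Q (P ++ Q)
  ι₂ P Q = ¡ P ⊕ idᵗ Q

  -- The source is a single word because there appending `[]` computes away, and no cast is left on
  -- the right-hand side.
  ⨾-ι₁ : ∀ {U} (f : Tape (U ∷ []) P) → f ⨾ ι₁ P Q ≈ f ⊕ ¡ Q
  ⨾-ι₁ {P} {Q} f = begin
    f ⨾ ι₁ P Q
      ≈⟨ ⨾-cong ⊕-unitʳ ≈-refl ⟨
    cast ≡.refl (++-identityʳ P) (f ⊕ id₀) ⨾ cast (++-identityʳ P) ≡.refl (idᵗ P ⊕ ¡ Q)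
      ≡⟨ cast-⨾ ≡.refl (++-identityʳ P) ≡.refl ⟩
    (f ⊕ id₀) ⨾ (idᵗ P ⊕ ¡ Q)
      ≈⟨ ⊕-⨾-cong ⨾-idʳ ⨾-idˡ ⟩
    f ⊕ ¡ Q ∎

  ⨾-ι₂ : ∀ (f : Tape P Q) → f ⨾ ι₂ S Q ≈ ¡ S ⊕ f
  ⨾-ι₂ {P} {Q} {S} f = begin
    f ⨾ (¡ S ⊕ idᵗ Q)          ≈⟨ ⨾-cong ⊕-unitˡ ≈-refl ⟨
    (id₀ ⊕ f) ⨾ (¡ S ⊕ idᵗ Q)  ≈⟨ ⊕-⨾-cong ⨾-idˡ ⨾-idʳ ⟩
    ¡ S ⊕ f                    ∎

  ∇₁-unitʳ : ∀ U → (id₁ U ⊕ ¡₁ U) ⨾ ∇₁ U ≈ id₁ U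
  ∇₁-unitʳ U = ≈-trans (⨾-cong (⊕-cong (≈-sym (idᵗ-[-] U)) (≈-sym (¡-[-] U))) (≈-sym (∇-[-] U)))
    (≈-trans (∇-unitʳ (U ∷ [])) (idᵗ-[-] U))

  ∇₁-unitˡ : ∀ U → (¡₁ U ⊕ id₁ U) ⨾ ∇₁ U ≈ id₁ U
  ∇₁-unitˡ U = ≈-trans (⨾-cong (⊕-cong (≈-sym (¡-[-] U)) (≈-sym (idᵗ-[-] U))) (≈-sym (∇-[-] U)))
    (≈-trans (∇-unitˡ (U ∷ [])) (idᵗ-[-] U))

  copair-ι : ∀ U P → ((id₁ U ⊕ ¡ P) ⊕ (¡₁ U ⊕ idᵗ P)) ⨾ ∇ (U ∷ P) ≈ idᵗ (U ∷ P)
  copair-ι U P = begin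
    ((id₁ U ⊕ ¡ P) ⊕ (¡₁ U ⊕ idᵗ P)) ⨾ ∇ (U ∷ P)
      ≈⟨ ⨾-cong (≈-trans ⊕-assoc (⊕-cong ≈-refl (≈-sym ⊕-assoc))) ≈-refl ⟩
    (id₁ U ⊕ cast ≡.refl a ((¡ P ⊕ ¡₁ U) ⊕ idᵗ P)) ⨾ ∇ (U ∷ P)
      ≡⟨ ≡.cong (_⨾ ∇ (U ∷ P)) (⊕-castʳ a) ⟩
    cast ≡.refl (≡.cong (U ∷_) a) (id₁ U ⊕ (¡ P ⊕ ¡₁ U) ⊕ idᵗ P) ⨾
      cast (≡.cong (U ∷_) a) ≡.refl (id₁ U ⊕ σ⊕ P (U ∷ []) ⊕ idᵗ P) ⨾ (∇₁ U ⊕ ∇ P)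
      ≈⟨ ⨾-assoc ⟨
    (cast ≡.refl (≡.cong (U ∷_) a) (id₁ U ⊕ (¡ P ⊕ ¡₁ U) ⊕ idᵗ P) ⨾
      cast (≡.cong (U ∷_) a) ≡.refl (id₁ U ⊕ σ⊕ P (U ∷ []) ⊕ idᵗ P)) ⨾ (∇₁ U ⊕ ∇ P)
      ≡⟨ ≡.cong (_⨾ (∇₁ U ⊕ ∇ P)) (cast-⨾ ≡.refl (≡.cong (U ∷_) a) ≡.refl) ⟩
    ((id₁ U ⊕ (¡ P ⊕ ¡₁ U) ⊕ idᵗ P) ⨾ (id₁ U ⊕ σ⊕ P (U ∷ []) ⊕ idᵗ P)) ⨾ (∇₁ U ⊕ ∇ P)
      -- The symmetry inside `∇ (U ∷ P)` meets only the two maps out of `[]`; naturality exchanges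
      -- them, and the unit laws of `∇` apply in each summand.
      ≈⟨ ⨾-cong (⊕-⨾-cong id₁-⨾ (⊕-⨾-cong
           (≈-trans (⨾-cong (⊕-cong ≈-refl (≈-sym (¡-[-] U))) ≈-refl) (≈-trans σ-natural
             (≈-trans ⨾-idˡ (⊕-cong (¡-[-] U) ≈-refl)))) ⨾-idˡ)) ≈-refl ⟩
    (id₁ U ⊕ (¡₁ U ⊕ ¡ P) ⊕ idᵗ P) ⨾ (∇₁ U ⊕ ∇ P)
      ≈⟨ ⨾-cong (≈-trans (⊕-cong ≈-refl ⊕-assoc) (≈-sym ⊕-assoc)) ≈-refl ⟩
    ((id₁ U ⊕ ¡₁ U) ⊕ (¡ P ⊕ idᵗ P)) ⨾ (∇₁ U ⊕ ∇ P)
      ≈⟨ ⊕-⨾-cong (∇₁-unitʳ U) (∇-unitˡ P) ⟩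
    id₁ U ⊕ idᵗ P ∎
    where a = ++-assoc P (U ∷ []) P

  copair-η : ∀ {U} (f : Tape (U ∷ P) Q) →
             f ≈ (((id₁ U ⊕ ¡ P) ⨾ f) ⊕ ((¡₁ U ⊕ idᵗ P) ⨾ f)) ⨾ ∇ Q
  copair-η {P} {Q} {U} f = begin
    f                                                            ≈⟨ ⨾-idˡ ⟨
    idᵗ (U ∷ P) ⨾ f                                              ≈⟨ ⨾-cong (copair-ι U P) ≈-refl ⟨
    (((id₁ U ⊕ ¡ P) ⊕ (¡₁ U ⊕ idᵗ P)) ⨾ ∇ (U ∷ P)) ⨾ f           ≈⟨ ⨾-assoc ⟩
    ((id₁ U ⊕ ¡ P) ⊕ (¡₁ U ⊕ idᵗ P)) ⨾ ∇ (U ∷ P) ⨾ f             ≈⟨ ⨾-cong ≈-refl (∇-natural f) ⟩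
    ((id₁ U ⊕ ¡ P) ⊕ (¡₁ U ⊕ idᵗ P)) ⨾ (f ⊕ f) ⨾ ∇ Q             ≈⟨ ⨾-assoc ⟨
    (((id₁ U ⊕ ¡ P) ⊕ (¡₁ U ⊕ idᵗ P)) ⨾ (f ⊕ f)) ⨾ ∇ Q           ≈⟨ ⨾-cong ⊕-⨾ ≈-refl ⟨
    (((id₁ U ⊕ ¡ P) ⨾ f) ⊕ ((¡₁ U ⊕ idᵗ P) ⨾ f)) ⨾ ∇ Q           ∎

-- Points of objects, failure and extensionality

module States {c ℓ₁ ℓ₂} (R : Reals c ℓ₁ ℓ₂) where
  open Reals R using () renaming (_≈_ to _≈ℝ_; refl to ≈ℝ-refl)
  open OpenUnitInterval R
  open Tapes R
  open TapeLaws R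
  open ClosedCircuits
  open Barycentric R using (ConvexAlgebra)

  private
    variable
      P Q : Objects

  ∼-refl : {f : Tape P Q} → f ∼̇ f
  ∼-refl = incl ≈-refl

  ∼-setoid : Objects → Objects → Setoid _ _
  ∼-setoid P Q = record
    { Carrier = Tape P Q ; _≈_ = _∼̇_
    ; isEquivalence = record { refl = ∼-refl ; sym = ∼-sym ; trans = ∼-trans } }

  private open module Reasoning {P Q} = SetoidReasoning (∼-setoid P Q)

  +-cong : ∀ {p q} {f f′ g g′ : Tape P Q} → value p ≈ℝ value q → f ∼̇ f′ → g ∼̇ g′ →
           f +[ p ] g ∼̇ f′ +[ q ] g′
  +-cong {P} e e₁ e₂ = ⨾-cong (incl (Δ-cong P e)) (⨾-cong (⊕-cong e₁ e₂) ∼-refl)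

  tapeAlgebra : ∀ P Q → ConvexAlgebra _ _
  tapeAlgebra P Q = record
    { Carrier       = Tape P Q
    ; _∼_           = _∼̇_
    ; isEquivalence = Setoid.isEquivalence (∼-setoid P Q)
    ; convex        = λ p f g → f +[ p ] g
    ; convex-cong   = +-cong
    ; convex-idem   = λ p f → incl (+-idem p f)
    ; convex-comm   = λ p f g → incl (+-comm p f g)
    ; convex-assoc  = λ p q f g h → incl (+-assoc p q f g h)
    }

  ⌜⌝-resp : ∀ {n m} {c d : Diag n m} {f} → c ≃ d → ⌜ d ⌝ ∼̇ f → ⌜ c ⌝ ∼̇ f
  ⌜⌝-resp e e′ = ∼-trans (PB-eq e) e′

  ⌜⌝-fail-⨟ : ∀ {n m} {c : Diag 0 n} {d : Diag n m} →
              ⌜ c ⌝ ∼̇ ⋆ (0 ∷ []) (n ∷ []) → ⌜ c ⨟ d ⌝ ∼̇ ⋆ (0 ∷ []) (m ∷ [])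
  ⌜⌝-fail-⨟ e = ∼-trans (incl ⌜⌝-⨟) (∼-trans (⨾-cong e ∼-refl) (incl (⋆-⨾ _)))

  -- Once the tensor is sequentialised with the failing factor in front, `⋆` absorbs the rest.
  ⌜⌝-fail-⊗ʳ : ∀ {n m} (c : Diag 0 n) {d : Diag 0 m} →
               ⌜ d ⌝ ∼̇ ⋆ (0 ∷ []) (m ∷ []) → ⌜ c ⊗ d ⌝ ∼̇ ⋆ (0 ∷ []) (n +ℕ m ∷ [])
  ⌜⌝-fail-⊗ʳ c {d} e = ⌜⌝-resp (⊗-as-⨟ c d) (⌜⌝-fail-⨟ e)

  ⌜⌝-fail-⊗ˡ : ∀ {n m} {c : Diag 0 n} (d : Diag 0 m) →
               ⌜ c ⌝ ∼̇ ⋆ (0 ∷ []) (n ∷ []) → ⌜ c ⊗ d ⌝ ∼̇ ⋆ (0 ∷ []) (n +ℕ m ∷ [])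
  ⌜⌝-fail-⊗ˡ {c = c} d e = ⌜⌝-resp (≈-sym (⊗-swap d c)) (⌜⌝-fail-⨟ (⌜⌝-fail-⊗ʳ d e))

  -- The only partial generator is `cocopy`, so T1 is applied there. In a composite whose first part
  -- is defined, that part is evaluated by `const-⨟`.
  const-fail : ∀ {n m} (c : Diag n m) v → ⟦ c ⟧ v ≡ nothing →
               ⌜ const v ⨟ c ⌝ ∼̇ ⋆ (0 ∷ []) (m ∷ [])
  const-fail ∧ᶜ (_ ∷ _ ∷ []) ()
  const-fail ¬ᶜ (_ ∷ []) ()
  const-fail ttᶜ [] ()
  const-fail copyᶜ (_ ∷ []) ()
  const-fail delᶜ (_ ∷ []) ()
  const-fail cocopyᶜ v e = ⌜⌝-resp (const-cocopy-fail v e) T1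
  const-fail (idᶜ n) v ()
  const-fail (σ n m) v ()
  const-fail (c ⨟ d) v e with ⟦ c ⟧ v in eq
  ... | just w  = ⌜⌝-resp (≈-trans (≈-sym ⨟-assoc) (⨟-cong (const-⨟ c v eq) ≈-refl)) (const-fail d w e)
  ... | nothing = ⌜⌝-resp (≈-sym ⨟-assoc) (⌜⌝-fail-⨟ (const-fail c v eq))
  const-fail (_⊗_ {n = n} c d) v e with ⟦ c ⟧ (takeᵛ n v) in eq | ⟦ d ⟧ (dropᵛ n v) in eq′
  ... | nothing | _ =
    ⌜⌝-resp (≈-trans (⨟-cong (const-take-drop n v) ≈-refl) (≈-sym ⊗-⨟))
      (⌜⌝-fail-⊗ˡ _ (const-fail c _ eq))
  ... | just _ | nothing =
    ⌜⌝-resp (≈-trans (⨟-cong (const-take-drop n v) ≈-refl) (≈-sym ⊗-⨟))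
      (⌜⌝-fail-⊗ʳ _ (const-fail d _ eq′))

  -- Between single words the distributors are identities.
  ⊗ᵗ-id₁ : ∀ {U V} n (f : Tape (U ∷ []) (V ∷ [])) → f ⊗ᵗ id₁ n ≈ R₁ n f
  ⊗ᵗ-id₁ {U} {V} n f = ≈-trans ⨾-idˡ (≈-trans (⨾-cong δ≈id₁ (⨾-cong ⊕-unitʳ δ⁻¹≈id₁))
                         (≈-trans id₁-⨾ ⨾-id₁))
    where
    outer : ∀ {W} → idᵗ (W ∷ []) ⊕ id₀ ≈ id₁ W
    outer = ≈-trans ⊕-unitʳ ⊕-unitʳ
    inner : ∀ {W} → idᵗ (W ∷ []) ⊕ id₀ ⊕ id₀ ≈ id₁ W
    inner = ≈-trans (⊕-cong ≈-refl ⊕-unitˡ) outer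
    δ≈id₁ : δ (U ∷ []) (n ∷ []) [] ≈ id₁ (U +ℕ n)
    δ≈id₁ = ≈-trans (⨾-cong outer inner) id₁-⨾
    δ⁻¹≈id₁ : δ⁻¹ (V ∷ []) (n ∷ []) [] ≈ id₁ (V +ℕ n)
    δ⁻¹≈id₁ = ≈-trans (⨾-cong inner outer) id₁-⨾

  -- T2 speaks of a single wire; closure of `∼̇` under `⊗ᵗ` adds `n` idle ones. On the terms
  -- involved `R₁ n` computes to the tapes displayed.
  T2-whiskered : ∀ n → ½ · id₁ (suc n) ∼̇
    (⌜ test₁ ⊗ idᶜ n ⌝ ⨾ ⌜ ttᶜ ⊗ idᶜ n ⌝) +[ ½ ] (⌜ test₀ ⊗ idᶜ n ⌝ ⨾ ⌜ ffᶜ ⊗ idᶜ n ⌝)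
  T2-whiskered n = ∼-trans (incl (≈-sym (⊗ᵗ-id₁ n (½ · id₁ 1))))
    (∼-trans (⊗-cong T2 (∼-refl {f = id₁ n})) (incl (⊗ᵗ-id₁ n ((⌜ test₁ ⌝ ⨾ ⌜ ttᶜ ⌝) +[ ½ ] (⌜ test₀ ⌝ ⨾ ⌜ ffᶜ ⌝)))))

  extensional₁ : ∀ n {f g : Tape (n ∷ []) Q} →
                 (∀ v → ⌜ const v ⌝ ⨾ f ∼̇ ⌜ const v ⌝ ⨾ g) → f ∼̇ g
  extensional₁ zero {f} {g} e = begin
    f            ≈⟨ incl id₁-⨾ ⟨
    id₁ 0 ⨾ f    ≈⟨ ⨾-cong (incl (⌜⌝-id 0)) ∼-refl ⟨
    ⌜ idᶜ 0 ⌝ ⨾ f ≈⟨ e [] ⟩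
    ⌜ idᶜ 0 ⌝ ⨾ g ≈⟨ ⨾-cong (incl (⌜⌝-id 0)) ∼-refl ⟩
    id₁ 0 ⨾ g    ≈⟨ incl id₁-⨾ ⟩
    g            ∎
  extensional₁ {Q} (suc n) {f} {g} e = T3 ½ (begin
    ½ · f               ≈⟨ half-id f ⟨
    (½ · id₁ _) ⨾ f     ≈⟨ split-bit f ⟩
    -- The tests are common to both sides. After them a constant bit has been fixed, and what
    -- follows starts from `n` wires, so the recursive call applies.
    _                   ≈⟨ +-cong ≈ℝ-refl (⨾-cong ∼-refl (restrict true)) (⨾-cong ∼-refl (restrict false)) ⟩
    _                   ≈⟨ split-bit g ⟨
    (½ · id₁ _) ⨾ g     ≈⟨ half-id g ⟩
    ½ · g               ∎)
    where
    half-id : (h : Tape (suc n ∷ []) Q) → (½ · id₁ (suc n)) ⨾ h ∼̇ ½ · h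
    half-id h = ∼-trans (incl (+-⨾ ½ _ _ h)) (+-cong ≈ℝ-refl (incl id₁-⨾) (incl (⋆-⨾ h)))

    split-bit : (h : Tape (suc n ∷ []) Q) → (½ · id₁ (suc n)) ⨾ h ∼̇
      (⌜ test₁ ⊗ idᶜ n ⌝ ⨾ ⌜ ttᶜ ⊗ idᶜ n ⌝ ⨾ h) +[ ½ ] (⌜ test₀ ⊗ idᶜ n ⌝ ⨾ ⌜ ffᶜ ⊗ idᶜ n ⌝ ⨾ h)
    split-bit h = ∼-trans (⨾-cong (T2-whiskered n) ∼-refl)
      (∼-trans (incl (+-⨾ ½ _ _ h)) (+-cong ≈ℝ-refl (incl ⨾-assoc) (incl ⨾-assoc)))

    const-cons-⨾ : ∀ b v (h : Tape (suc n ∷ []) Q) →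
                   ⌜ const v ⌝ ⨾ ⌜ bit b ⊗ idᶜ n ⌝ ⨾ h ∼̇ ⌜ const (b ∷ v) ⌝ ⨾ h
    const-cons-⨾ b v h = ∼-trans (incl (≈-trans (≈-sym ⨾-assoc) (⨾-cong (≈-sym ⌜⌝-⨟) ≈-refl)))
      (⨾-cong (PB-eq (≈-sym (⊗-as-⨟ (bit b) (const v)))) ∼-refl)

    restrict : ∀ b → ⌜ bit b ⊗ idᶜ n ⌝ ⨾ f ∼̇ ⌜ bit b ⊗ idᶜ n ⌝ ⨾ g
    restrict b = extensional₁ n (λ v → ∼-trans (const-cons-⨾ b v f)
      (∼-trans (e (b ∷ v)) (∼-sym (const-cons-⨾ b v g))))

  state : ∀ P → ∣ ⟦ P ⟧ᵒ ∣ → Tape (0 ∷ []) P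
  state (n ∷ P) (inj₁ v) = ⌜ const v ⌝ ⊕ ¡ P
  state (n ∷ P) (inj₂ x) = ¡₁ n ⊕ state P x

  state-[-] : ∀ {n} (v : Vec Bool n) → state (n ∷ []) (inj₁ v) ≈ ⌜ const v ⌝
  state-[-] v = ⊕-unitʳ

  state-inj₁ : ∀ {n} (v : Vec Bool n) → state (n ∷ P) (inj₁ v) ≈ ⌜ const v ⌝ ⨾ (id₁ n ⊕ ¡ P)
  state-inj₁ v = ≈-trans (≈-sym (⊕-⨾-cong ⨾-id₁ ⨾-idˡ)) (⨾-cong ⊕-unitʳ ≈-refl)

  state-inj₂ : ∀ {n} (x : ∣ ⟦ P ⟧ᵒ ∣) → state (n ∷ P) (inj₂ x) ≈ state P x ⨾ (¡₁ n ⊕ idᵗ P)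
  state-inj₂ x = ≈-trans (≈-sym (⊕-⨾-cong ⨾-idˡ ⨾-idʳ)) (⨾-cong ⊕-unitˡ ≈-refl)

  extensional : ∀ P {f g : Tape P Q} → (∀ x → state P x ⨾ f ∼̇ state P x ⨾ g) → f ∼̇ g
  extensional {Q} [] {f} {g} e = incl (≈-trans (initial f) (≈-sym (initial g)))
    where
    initial : (h : Tape [] Q) → h ≈ ¡ Q
    initial h = ≈-trans (≈-sym ⨾-idˡ) (¡-natural h)
  extensional {Q} (n ∷ P) {f} {g} e = begin
    f ≈⟨ incl (copair-η f) ⟩
    _ ≈⟨ ⨾-cong (⊕-cong (extensional₁ n (λ v → factor (state-inj₁ v) (e (inj₁ v))))
                        (extensional P (λ x → factor (state-inj₂ x) (e (inj₂ x))))) ∼-refl ⟩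
    _ ≈⟨ incl (copair-η g) ⟨
    g ∎
    where
    factor : ∀ {S} {s : Tape (0 ∷ []) (n ∷ P)} {s′ : Tape (0 ∷ []) S} {i : Tape S (n ∷ P)} →
             s ≈ s′ ⨾ i → s ⨾ f ∼̇ s ⨾ g → s′ ⨾ i ⨾ f ∼̇ s′ ⨾ i ⨾ g
    factor eq d = ∼-trans (incl (≈-trans (≈-sym ⨾-assoc) (⨾-cong (≈-sym eq) ≈-refl)))
      (∼-trans d (incl (≈-trans (⨾-cong eq ≈-refl) ⨾-assoc)))

-- Points of a concatenation

module Joining where

  join : ∀ P Q → ∣ ⟦ P ⟧ᵒ ⊎ᶠ ⟦ Q ⟧ᵒ ∣ → ∣ ⟦ P ++ Q ⟧ᵒ ∣
  join []      Q (inj₂ y)        = y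
  join (n ∷ P) Q (inj₁ (inj₁ v)) = inj₁ v
  join (n ∷ P) Q (inj₁ (inj₂ x)) = inj₂ (join P Q (inj₁ x))
  join (n ∷ P) Q (inj₂ y)        = inj₂ (join P Q (inj₂ y))

  split-join : ∀ P Q z → split P {Q} (join P Q z) ≡ z
  split-join []      Q (inj₂ y)        = ≡.refl
  split-join (n ∷ P) Q (inj₁ (inj₁ v)) = ≡.refl
  split-join (n ∷ P) Q (inj₁ (inj₂ x)) = ≡.cong (Sum.map₁ inj₂) (split-join P Q (inj₁ x))
  split-join (n ∷ P) Q (inj₂ y)        = ≡.cong (Sum.map₁ inj₂) (split-join P Q (inj₂ y))

  join-split : ∀ P Q x → join P Q (split P x) ≡ x
  join-split []      Q y        = ≡.refl
  join-split (n ∷ P) Q (inj₁ v) = ≡.refl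
  join-split (n ∷ P) Q (inj₂ r) with split P {Q} r | join-split P Q r
  ... | inj₁ x | eq = ≡.cong inj₂ eq
  ... | inj₂ y | eq = ≡.cong inj₂ eq

  join-injective : ∀ P Q {x y} → join P Q x ≡ join P Q y → x ≡ y
  join-injective P Q e =
    ≡.trans (≡.sym (split-join P Q _)) (≡.trans (≡.cong (split P) e) (split-join P Q _))

-- Subdistributions presented by trees

-- Trees with leaves in Maybe ∣ X ∣ present subdistributions on X, the leaf
-- nothing standing for the missing mass.
module Subtrees {c ℓ₁ ℓ₂} (R : Reals c ℓ₁ ℓ₂) where
  open Reals R renaming (Carrier to ℝ)
  open OpenUnitInterval R
  open RealProperties R using (x+z-z≈x; x-z+z≈x)
  open Subdistributions R
  open Barycentric R
  open SetoidReasoning setoid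

  Subtree : FinSet → Set _
  Subtree X = Tree (Maybe ∣ X ∣)

  module _ (X : FinSet) where
    open FinSet X

    points : List (Maybe ∣ X ∣)
    points = nothing ∷ map just elements

    points-unique : Unique points
    points-unique = All.map⁺ (All.universal (λ _ ()) elements) ∷ Unique.map⁺ just-injective unique

    points-finite : ∀ x → x ∈ points
    points-finite nothing  = here ≡.refl
    points-finite (just x) = there (∈-map⁺ just (finite x))

    module W = Weights (Maybe-≡-dec (FinSet._≟_ X))

  wt : ∀ {X} → Subtree X → Maybe ∣ X ∣ → Mass
  wt {X} = W.wt X

  infix 4 _presents_

  _presents_ : ∀ {X} → Subtree X → 𝒟≤ X → Set ℓ₁
  _presents_ {X} D d = ∀ x → mass (wt {X} D (just x)) ≈ weight d x

  module _ {X : FinSet} where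
    open FinSet X
    open W X using (mass-leaf; mass-node; ∑-wt-leaf; ∑-wt-node)

    presents-dirac : ∀ x → leaf (just x) presents dirac {X} x
    presents-dirac x y = mass-leaf (just x) (just y)

    presents-mix : ∀ p D E (d e : 𝒟≤ X) → D presents d → E presents e →
                   node p D E presents mix p d e
    presents-mix p D E d e D-d E-e x =
      trans (mass-node p D E (just x)) (+-cong (*-congˡ (D-d x)) (*-congˡ (E-e x)))

    total+missing : ∀ (D : Subtree X) → ∑ (points X) (λ y → mass (wt {X} D y) * 1#) ≈ 1#
    total+missing (leaf x) = ∑-wt-leaf (points-unique X) (points-finite X) x (λ _ → 1#)
    total+missing (node p D E) = begin
      ∑ (points X) (λ y → mass (wt {X} (node p D E) y) * 1#)
        ≈⟨ ∑-wt-node (points-unique X) (points-finite X) p D E (λ _ → 1#) ⟩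
      value p * ∑ (points X) (λ y → mass (wt {X} D y) * 1#) +
      value (1- p) * ∑ (points X) (λ y → mass (wt {X} E y) * 1#)
        ≈⟨ +-cong (*-congˡ (total+missing D)) (*-congˡ (total+missing E)) ⟩
      value p * 1# + value (1- p) * 1#
        ≈⟨ +-cong (*-identityʳ _) (*-identityʳ _) ⟩
      value p + value (1- p)
        ≈⟨ trans (+-comm _ _) (x-z+z≈x 1# (value p)) ⟩
      1# ∎

    -- Presenting `d` says nothing about the leaf `nothing`; since all masses of a tree add up to 1,
    -- its mass is determined by the others.
    presents-unique : ∀ {D E} {d : 𝒟≤ X} → D presents d → E presents d →
                      ∀ y → mass (wt {X} D y) ≈ mass (wt {X} E y)
    presents-unique D-d E-d (just x) = trans (D-d x) (sym (E-d x))
    presents-unique {D} {E} D-d E-d nothing = begin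
      m D                    ≈⟨ x+z-z≈x _ _ ⟨
      m D + rest D - rest D  ≈⟨ +-cong (trans (sums D) (sym (sums E))) (-‿cong rest-cong) ⟩
      m E + rest E - rest E  ≈⟨ x+z-z≈x _ _ ⟩
      m E                    ∎
      where
      m rest : Subtree X → ℝ
      m D = mass (wt {X} D nothing)
      rest D = ∑ (map just elements) (λ y → mass (wt {X} D y) * 1#)
      sums : ∀ D → m D + rest D ≈ 1#
      sums D = trans (+-congʳ (sym (*-identityʳ _))) (total+missing D)
      rest-cong : rest D ≈ rest E
      rest-cong = begin
        rest D ≡⟨ ∑-map just elements _ ⟩
        ∑ elements (λ x → mass (wt {X} D (just x)) * 1#)
          ≈⟨ ∑-cong elements (λ x → *-congʳ (trans (D-d x) (sym (E-d x)))) ⟩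
        ∑ elements (λ x → mass (wt {X} E (just x)) * 1#) ≡⟨ ∑-map just elements _ ⟨
        rest E ∎

  module _ {X Y : FinSet} where
    private module X = FinSet X

    bind : Subtree X → (∣ X ∣ → Subtree Y) → Subtree Y
    bind D k = D >>=ᵗ maybe′ k (leaf nothing)

    private
      wt-bind : ∀ D k y → mass (wt {Y} (bind D k) (just y)) ≈
        ∑ (points X) (λ x → mass (wt {X} D x) * mass (wt {Y} (maybe′ k (leaf nothing) x) (just y)))
      wt-bind (leaf x) k y = sym (W.∑-wt-leaf X (points-unique X) (points-finite X) x _)
      wt-bind (node p D E) k y = begin
        mass (wt {Y} (bind (node p D E) k) (just y))
          ≈⟨ W.mass-node Y p (bind D k) (bind E k) (just y) ⟩
        value p * mass (wt {Y} (bind D k) (just y)) +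
        value (1- p) * mass (wt {Y} (bind E k) (just y))
          ≈⟨ +-cong (*-congˡ (wt-bind D k y)) (*-congˡ (wt-bind E k y)) ⟩
        _ ≈⟨ W.∑-wt-node X (points-unique X) (points-finite X) p D E _ ⟨
        ∑ (points X) (λ x → mass (wt {X} (node p D E) x) * mass (wt {Y} (maybe′ k (leaf nothing) x) (just y))) ∎

    presents-bind : ∀ {W} (f : Kl W X) (g : Kl X Y) {w D k} → D presents f w →
                    (∀ x → k x presents g x) → bind D k presents (_⨾ₖ_ {W} {X} {Y} f g) w
    presents-bind f g {w} {D} {k} D-d k-g y = begin
      mass (wt {Y} (bind D k) (just y))
        ≈⟨ wt-bind D k y ⟩
      -- The factor `0#` is `h nothing`: missing mass stays missing and reaches no point of `Y`.
      mass (wt {X} D nothing) * 0# + ∑ (map just X.elements) (λ x → mass (wt {X} D x) * h x)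
        ≈⟨ trans (+-congʳ (zeroʳ _)) (+-identityˡ _) ⟩
      ∑ (map just X.elements) (λ x → mass (wt {X} D x) * h x)
        ≡⟨ ∑-map just X.elements _ ⟩
      ∑ X.elements (λ x → mass (wt {X} D (just x)) * h (just x))
        ≈⟨ ∑-cong X.elements (λ x → *-cong (D-d x) (k-g x y)) ⟩
      ∑ X.elements (λ x → weight (f w) x * weight (g x) y) ∎
      where
      h : Maybe ∣ X ∣ → ℝ
      h x = mass (wt {Y} (maybe′ k (leaf nothing) x) (just y))

    relabel : (∣ X ∣ → ∣ Y ∣) → Subtree X → Subtree Y
    relabel j D = bind D (leaf ∘ just ∘ j)

    -- Injectivity prevents the masses of distinct points from being merged.
    wt-relabel : ∀ {j} → (∀ {x x′} → j x ≡ j x′ → x ≡ x′) → ∀ D x →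
                 wt {Y} (relabel j D) (just (j x)) ≡ wt {X} D (just x)
    wt-relabel j-inj (leaf nothing) x = ≡.refl
    wt-relabel {j} j-inj (leaf (just x′)) x with FinSet._≟_ Y (j x′) (j x) | FinSet._≟_ X x′ x
    ... | yes _ | yes _ = ≡.refl
    ... | no  _ | no  _ = ≡.refl
    ... | yes e | no  n = ⊥-elim (n (j-inj e))
    ... | no  n | yes e = ⊥-elim (n (≡.cong j e))
    wt-relabel j-inj (node p D E) x =
      ≡.cong₂ (λ u v → _ *ᵐ u +ᵐ _ *ᵐ v) (wt-relabel j-inj D x) (wt-relabel j-inj E x)

    wt-relabel-∉ : ∀ {j} D {y} → (∀ x → j x ≢ y) → wt {Y} (relabel j D) (just y) ≡ nothing
    wt-relabel-∉ (leaf nothing) ∉ = ≡.refl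
    wt-relabel-∉ {j} (leaf (just x)) {y} ∉ with FinSet._≟_ Y (j x) y
    ... | yes e = ⊥-elim (∉ x e)
    ... | no  _ = ≡.refl
    wt-relabel-∉ (node p D E) ∉ =
      ≡.cong₂ (λ u v → _ *ᵐ u +ᵐ _ *ᵐ v) (wt-relabel-∉ D ∉) (wt-relabel-∉ E ∉)

  module _ (P Q : Objects) where
    open Joining

    presents-inl : ∀ {D} {d : 𝒟≤ ⟦ P ⟧ᵒ} → D presents d →
      relabel {⟦ P ⟧ᵒ} {⟦ P ++ Q ⟧ᵒ} (join P Q ∘ inj₁) D presents
      unsplit P Q (inl {⟦ P ⟧ᵒ} {⟦ Q ⟧ᵒ} d)
    -- Matching on `join-split` puts `z` into the image of `join`, where the weights of relabelled
    -- trees are known.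
    presents-inl {D} {d} D-d z with split P z | join-split P Q z
    ... | inj₁ x | ≡.refl = trans (reflexive (≡.cong mass
      (wt-relabel {⟦ P ⟧ᵒ} {⟦ P ++ Q ⟧ᵒ} (inj₁-injective ∘ join-injective P Q ) D x))) (D-d x)
    ... | inj₂ y | ≡.refl = reflexive (≡.cong mass
      (wt-relabel-∉ {⟦ P ⟧ᵒ} {⟦ P ++ Q ⟧ᵒ} D (λ x e → case (join-injective P Q e))))
      where
      case : ∀ {x y} → inj₁ x ≢ inj₂ y
      case ()

    presents-inr : ∀ {D} {d : 𝒟≤ ⟦ Q ⟧ᵒ} → D presents d →
      relabel {⟦ Q ⟧ᵒ} {⟦ P ++ Q ⟧ᵒ} (join P Q ∘ inj₂) D presents
      unsplit P Q (inr {⟦ P ⟧ᵒ} {⟦ Q ⟧ᵒ} d)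
    presents-inr {D} {d} D-d z with split P z | join-split P Q z
    ... | inj₂ y | ≡.refl = trans (reflexive (≡.cong mass
      (wt-relabel {⟦ Q ⟧ᵒ} {⟦ P ++ Q ⟧ᵒ} (inj₂-injective ∘ join-injective P Q ) D y))) (D-d y)
    ... | inj₁ x | ≡.refl = reflexive (≡.cong mass
      (wt-relabel-∉ {⟦ Q ⟧ᵒ} {⟦ P ++ Q ⟧ᵒ} D (λ y e → case (join-injective P Q e))))
      where
      case : ∀ {x y} → inj₂ x ≢ inj₁ y
      case ()

-- Tapes realise their denotations

module Completeness {c ℓ₁ ℓ₂} (R : Reals c ℓ₁ ℓ₂) where
  open Reals R using () renaming (_≈_ to _≈ℝ_; refl to ≈ℝ-refl; sym to ≈ℝ-sym; trans to ≈ℝ-trans)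
  open Tapes R
  open Subdistributions R
  open Semantics R
  open Barycentric R
  open Subtrees R
  open TapeLaws R
  open States R
  open ClosedCircuits
  open Joining

  private
    variable
      P Q Q′ : Objects

  -- Missing mass is read as the tape `⋆`, one more point of the convex algebra of tapes out of the
  -- unit.
  module Ev (P : Objects) =
    Cone.Evaluation (tapeAlgebra (0 ∷ []) P) (Maybe-≡-dec (FinSet._≟_ ⟦ P ⟧ᵒ)) (maybe′ (state P) (⋆ (0 ∷ []) P))

  eval : Subtree ⟦ P ⟧ᵒ → Tape (0 ∷ []) P
  eval {P} = Ev.eval P

  state-join₁ : ∀ P Q x → state (P ++ Q) (join P Q (inj₁ x)) ≈ state P x ⊕ ¡ Q
  state-join₁ (n ∷ P) Q (inj₁ v) =
    -- Initiality of `[]` identifies `¡ (P ++ Q)` with `¡ P ⊕ ¡ Q`.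
    ≈-trans (⊕-cong ≈-refl (≈-trans (≈-sym (¡-natural (¡ P ⊕ ¡ Q))) ⨾-idˡ)) (≈-sym ⊕-assoc)
  state-join₁ (n ∷ P) Q (inj₂ x) = ≈-trans (⊕-cong ≈-refl (state-join₁ P Q x)) (≈-sym ⊕-assoc)

  state-join₂ : ∀ P Q y → state (P ++ Q) (join P Q (inj₂ y)) ≈ ¡ P ⊕ state Q y
  state-join₂ []      Q y = ≈-sym ⊕-unitˡ
  state-join₂ (n ∷ P) Q y = ≈-trans (⊕-cong ≈-refl (state-join₂ P Q y)) (≈-sym ⊕-assoc)

  -- Naturality of `Δ` produces two copies of the constant; inserting the identity as the copairing
  -- of the two injections supplies the `∇` of a convex combination.
  state-Δ₁ : ∀ p {U} (v : Vec Bool U) → state (U ∷ []) (inj₁ v) ⨾ Δ₁ p U ≈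
             state (U ∷ U ∷ []) (inj₁ v) +[ p ] state (U ∷ U ∷ []) (inj₂ (inj₁ v))
  state-Δ₁ p {U} v = begin
    state (U ∷ []) (inj₁ v) ⨾ Δ₁ p U
      ≈⟨ ⨾-cong (state-[-] v) (≈-sym (Δ-[-] p U)) ⟩
    ⌜ const v ⌝ ⨾ Δ p (U ∷ [])
      ≈⟨ Δ-natural p ⌜ const v ⌝ ⟩
    Δ p (0 ∷ []) ⨾ (⌜ const v ⌝ ⊕ ⌜ const v ⌝)
      ≈⟨ ⨾-cong ≈-refl ⨾-idʳ ⟨
    Δ p (0 ∷ []) ⨾ (⌜ const v ⌝ ⊕ ⌜ const v ⌝) ⨾ idᵗ (U ∷ U ∷ [])
      ≈⟨ ⨾-cong ≈-refl (⨾-cong ≈-refl (copair-ι U (U ∷ []))) ⟨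
    Δ p (0 ∷ []) ⨾ (⌜ const v ⌝ ⊕ ⌜ const v ⌝) ⨾
      ((id₁ U ⊕ ¡ (U ∷ [])) ⊕ (¡₁ U ⊕ idᵗ (U ∷ []))) ⨾ ∇ (U ∷ U ∷ [])
      ≈⟨ ⨾-cong ≈-refl ⨾-assoc ⟨
    Δ p (0 ∷ []) ⨾ ((⌜ const v ⌝ ⊕ ⌜ const v ⌝) ⨾
      ((id₁ U ⊕ ¡ (U ∷ [])) ⊕ (¡₁ U ⊕ idᵗ (U ∷ [])))) ⨾ ∇ (U ∷ U ∷ [])
      ≈⟨ ⨾-cong ≈-refl (⨾-cong (⊕-⨾-cong (≈-sym (state-inj₁ v))
           (≈-trans (⨾-cong (≈-sym (state-[-] v)) ≈-refl) (≈-sym (state-inj₂ (inj₁ v))))) ≈-refl) ⟩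
    state (U ∷ U ∷ []) (inj₁ v) +[ p ] state (U ∷ U ∷ []) (inj₂ (inj₁ v)) ∎
    where open module Reasoning {P Q} = SetoidReasoning (tapeSetoid P Q)

  module _ {U} (v : Vec Bool U) where

    state-!₁ : state (U ∷ []) (inj₁ v) ⨾ !₁ U ≈ ⋆ (0 ∷ []) []
    state-!₁ = ≈-trans (⨾-cong ≈-refl (≈-sym (!-[-] U))) (≈-trans (!-natural _) (≈-sym ⨾-idʳ))

    state-∇₁ˡ : state (U ∷ U ∷ []) (inj₁ v) ⨾ ∇₁ U ≈ state (U ∷ []) (inj₁ v)
    state-∇₁ˡ = ≈-trans (⨾-cong (state-inj₁ v) ≈-refl) (≈-trans ⨾-assoc (≈-trans
      (⨾-cong ≈-refl (≈-trans (⨾-cong (⊕-cong ≈-refl (¡-[-] U)) ≈-refl) (∇₁-unitʳ U)))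
      (≈-trans ⨾-id₁ (≈-sym (state-[-] v)))))

    state-∇₁ʳ : state (U ∷ U ∷ []) (inj₂ (inj₁ v)) ⨾ ∇₁ U ≈ state (U ∷ []) (inj₁ v)
    state-∇₁ʳ = ≈-trans (⨾-cong (state-inj₂ (inj₁ v)) ≈-refl) (≈-trans ⨾-assoc (≈-trans
      (⨾-cong ≈-refl (≈-trans (⨾-cong (⊕-cong ≈-refl (idᵗ-[-] U)) ≈-refl) (∇₁-unitˡ U)))
      ⨾-id₁))

    state-σ₁ˡ : ∀ V → state (U ∷ V ∷ []) (inj₁ v) ⨾ σ₁ U V ≈ state (V ∷ U ∷ []) (inj₂ (inj₁ v))
    state-σ₁ˡ V = ≈-trans (⨾-cong ≈-refl (≈-sym (σ⊕-[-] U V))) (≈-trans σ-natural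
      (≈-trans (⨾-cong (σ⊕-unitʳ 0) ≈-refl) (≈-trans id₁-⨾
        (⊕-cong (¡-[-] V) (≈-sym (state-[-] v))))))

    state-σ₁ʳ : ∀ V → state (V ∷ U ∷ []) (inj₂ (inj₁ v)) ⨾ σ₁ V U ≈ state (U ∷ V ∷ []) (inj₁ v)
    state-σ₁ʳ V = ≈-trans
      (⨾-cong (⊕-cong (≈-sym (¡-[-] V)) (state-[-] v)) (≈-sym (σ⊕-[-] V U)))
      (≈-trans σ-natural ⨾-idˡ)

  -- Postcomposition preserves convex combinations, because `∇` is natural, and `⋆`, because `¡` is.
  -- Hence its values at the states determine it on trees.
  eval-bind : ∀ (g : Tape P Q) k → (∀ x → state P x ⨾ g ∼̇ eval (k x)) →
              ∀ D → eval D ⨾ g ∼̇ eval {Q} (bind {⟦ P ⟧ᵒ} {⟦ Q ⟧ᵒ} D k)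
  eval-bind g k e (leaf nothing)  = incl (⋆-⨾ g)
  eval-bind g k e (leaf (just x)) = e x
  eval-bind {P} {Q} g k e (node p D E) = ∼-trans (incl (+-⨾ p (eval {P} D) (eval {P} E) g))
    (+-cong ≈ℝ-refl (eval-bind g k e D) (eval-bind g k e E))

  infix 4 _realises_

  -- One tree has to describe both the tape up to `∼̇` and the weights of `d`; it is the link
  -- between syntax and semantics.
  _realises_ : Tape (0 ∷ []) Q → 𝒟≤ ⟦ Q ⟧ᵒ → Set _
  _realises_ {Q} f d = ∃[ D ] f ∼̇ eval {Q} D × _presents_ {⟦ Q ⟧ᵒ} D d

  realises-dirac : ∀ {f : Tape (0 ∷ []) Q} x → f ≈ state Q x → f realises dirac {⟦ Q ⟧ᵒ} x
  realises-dirac {Q} x e = leaf (just x) , incl e , presents-dirac {⟦ Q ⟧ᵒ} x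

  -- The value `w` is a separate argument so that matching on it keeps the equation required by
  -- `const-⨟` and `const-fail`.
  realises-evaluation : ∀ {n m} (c : Diag n m) v w → ⟦ c ⟧ v ≡ w →
    state (n ∷ []) (inj₁ v) ⨾ ⌜ c ⌝ realises inl {2^ m} {∅} (maybe′ dirac 𝟎 w)
  realises-evaluation {m = m} c v (just w) eq =
    leaf (just (inj₁ w)) ,
    ∼-trans (incl (≈-trans (⨾-cong (state-[-] v) ≈-refl) (≈-sym ⌜⌝-⨟)))
      (∼-trans (PB-eq (const-⨟ c v eq)) (incl (≈-sym (state-[-] w)))) ,
    λ { (inj₁ y) → presents-dirac {⟦ m ∷ [] ⟧ᵒ} (inj₁ w) (inj₁ y) }
  realises-evaluation {m = m} c v nothing eq =
    leaf nothing ,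
    ∼-trans (incl (≈-trans (⨾-cong (state-[-] v) ≈-refl) (≈-sym ⌜⌝-⨟))) (const-fail c v eq) ,
    λ { (inj₁ y) → ≈ℝ-refl }

  -- Adding `¡ Q′` is postcomposition with an injection, which acts on trees by relabelling.
  realises-inl : ∀ {f : Tape (0 ∷ []) Q} {d} → f realises d →
                 f ⊕ ¡ Q′ realises unsplit Q Q′ (inl {⟦ Q ⟧ᵒ} {⟦ Q′ ⟧ᵒ} d)
  realises-inl {Q} {Q′} {f} {d} (D , e , D-d) =
    relabel {⟦ Q ⟧ᵒ} {⟦ Q ++ Q′ ⟧ᵒ} (join Q Q′ ∘ inj₁) D ,
    ∼-trans (incl (≈-sym (⨾-ι₁ f))) (∼-trans (⨾-cong e ∼-refl)
      (eval-bind (ι₁ Q Q′) _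
        (λ x → incl (≈-trans (⨾-ι₁ (state Q x)) (≈-sym (state-join₁ Q Q′ x)))) D)) ,
    presents-inl Q Q′ {D} {d} D-d

  realises-inr : ∀ {f : Tape (0 ∷ []) Q′} {d} → f realises d →
                 ¡ Q ⊕ f realises unsplit Q Q′ (inr {⟦ Q ⟧ᵒ} {⟦ Q′ ⟧ᵒ} d)
  realises-inr {Q′} {Q} {f} {d} (D , e , D-d) =
    relabel {⟦ Q′ ⟧ᵒ} {⟦ Q ++ Q′ ⟧ᵒ} (join Q Q′ ∘ inj₂) D ,
    ∼-trans (incl (≈-sym (⨾-ι₂ f))) (∼-trans (⨾-cong e ∼-refl)
      (eval-bind (ι₂ Q Q′) _
        (λ x → incl (≈-trans (⨾-ι₂ (state Q′ x)) (≈-sym (state-join₂ Q Q′ x)))) D)) ,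
    presents-inr Q Q′ {D} {d} D-d

  realises-resp : ∀ {f g : Tape (0 ∷ []) Q} {d} → f ≈ g → g realises d → f realises d
  realises-resp e (D , e′ , D-d) = D , ∼-trans (incl e) e′ , D-d

  realises-denotation : ∀ {P} (f : Tape P Q) x → state P x ⨾ f realises ⟪ f ⟫ x
  realises-denotation (Δ₁ p U) (inj₁ v) =
    node p (leaf (just x₁)) (leaf (just x₂)) ,
    incl (state-Δ₁ p v) ,
    presents-mix {⟦ U ∷ U ∷ [] ⟧ᵒ} p (leaf (just x₁)) (leaf (just x₂)) (dirac x₁) (dirac x₂)
      (presents-dirac {⟦ U ∷ U ∷ [] ⟧ᵒ} x₁) (presents-dirac {⟦ U ∷ U ∷ [] ⟧ᵒ} x₂)
    where
    x₁ x₂ : ∣ ⟦ U ∷ U ∷ [] ⟧ᵒ ∣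
    x₁ = inj₁ v
    x₂ = inj₂ (inj₁ v)
  realises-denotation (!₁ U) (inj₁ v) = leaf nothing , incl (state-!₁ v) , (λ ())
  realises-denotation (∇₁ U) (inj₁ v) = realises-dirac (inj₁ v) (state-∇₁ˡ v)
  realises-denotation (∇₁ U) (inj₂ (inj₁ v)) = realises-dirac (inj₁ v) (state-∇₁ʳ v)
  realises-denotation ⌜ c ⌝ (inj₁ v) = realises-evaluation c v (⟦ c ⟧ v) ≡.refl
  realises-denotation (id₁ U) x = realises-dirac x ⨾-id₁
  realises-denotation (σ₁ U V) (inj₁ v) = realises-dirac (inj₂ (inj₁ v)) (state-σ₁ˡ v V)
  realises-denotation (σ₁ U V) (inj₂ (inj₁ v)) = realises-dirac (inj₁ v) (state-σ₁ʳ v U)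
  realises-denotation (_⨾_ {P} {Q} {S} f g) x with realises-denotation f x
  ... | D , e , D-f =
    bind {⟦ Q ⟧ᵒ} {⟦ S ⟧ᵒ} D (proj₁ ∘ realises-denotation g) ,
    ∼-trans (incl (≈-sym ⨾-assoc)) (∼-trans (⨾-cong e ∼-refl)
      (eval-bind g _ (proj₁ ∘ proj₂ ∘ realises-denotation g) D)) ,
    presents-bind {⟦ Q ⟧ᵒ} {⟦ S ⟧ᵒ} {⟦ P ⟧ᵒ} ⟪ f ⟫ ⟪ g ⟫ {x} {D} D-f
      (proj₂ ∘ proj₂ ∘ realises-denotation g)
  -- The point lies in one summand, so its state is padded by `¡` on the other, and naturality of
  -- `¡` absorbs the tape acting there.
  realises-denotation (_⊕_ {P} {Q} {P′} {Q′} f g) x with split P {P′} x | join-split P P′ x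
  ... | inj₁ y | ≡.refl = realises-resp {d = unsplit Q Q′ (inl {⟦ Q ⟧ᵒ} {⟦ Q′ ⟧ᵒ} (⟪ f ⟫ y))}
    (≈-trans (⨾-cong (state-join₁ P P′ y) ≈-refl) (⊕-⨾-cong ≈-refl (¡-natural g)))
    (realises-inl {d = ⟪ f ⟫ y} (realises-denotation f y))
  ... | inj₂ y | ≡.refl = realises-resp {d = unsplit Q Q′ (inr {⟦ Q ⟧ᵒ} {⟦ Q′ ⟧ᵒ} (⟪ g ⟫ y))}
    (≈-trans (⨾-cong (state-join₂ P P′ y) ≈-refl) (⊕-⨾-cong (¡-natural f) ≈-refl))
    (realises-inr {d = ⟪ g ⟫ y} (realises-denotation g y))

  complete : (s t : Tape P Q) → _≐_ {⟦ P ⟧ᵒ} {⟦ Q ⟧ᵒ} ⟪ s ⟫ ⟪ t ⟫ → s ∼̇ t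
  complete {P} {Q} s t e = extensional P agree
    where
    agree : ∀ x → state P x ⨾ s ∼̇ state P x ⨾ t
    agree x with realises-denotation s x | realises-denotation t x
    ... | D , s∼D , D-s | E , t∼E , E-t = ∼-trans s∼D (∼-trans
      (Ev.eval-cong Q (points-unique ⟦ Q ⟧ᵒ) (points-finite ⟦ Q ⟧ᵒ) D E
        (presents-unique {⟦ Q ⟧ᵒ} {D} {E} {⟪ s ⟫ x} D-s (λ y → ≈ℝ-trans (E-t y) (≈ℝ-sym (e x y)))))
      (∼-sym t∼E))

corollary29 : ∀ {c ℓ₁ ℓ₂} (R : Reals c ℓ₁ ℓ₂) →
    let open Tapes R
        open Subdistributions R
        open Semantics R
    in ∀ {P Q : Objects} (s t : Tape P Q) →
       _≐_ {⟦ P ⟧ᵒ} {⟦ Q ⟧ᵒ} ⟪ s ⟫ ⟪ t ⟫ → s ∼̇ t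
corollary29 R = Completeness.complete R
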